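{- Let $G_1$ and $G_2$ be finite simple graphs with the same number $n\ge 1$ of vertices, and suppose the centers of their Clifford graph algebras have the same dimension: $\dim_{\mathbb{C}} Z(A_{G_1}) = \dim_{\mathbb{C}} Z(A_{G_2})$. Then $A_{G_1}$ and $A_{G_2}$ are isomorphic as $\mathbb{C}$-algebras.
   Context: All graphs are finite, with no loops and no multiple edges. For a graph $G$ with vertices numbered $1,\dots,n$, the Clifford graph algebra $A_G$ is the unital associative $\mathbb{C}$-algebra generated by $e_1,\dots,e_n$ subject to the relations $e_i^2=-1$ for all $i$; $e_ie_j=-e_je_i$ if $i\neq j$ and vertices $i,j$ are adjacent; and $e_ie_j=e_je_i$ if $i\ne j$ and vertices $i,j$ are not adjacent. $Z(A)$ denotes the center of an algebra $A$. -}

module Defs where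

open import Level using (Level; 0ℓ; _⊔_; suc)
open import Algebra.Bundles using (CommutativeMonoid; Ring; CommutativeRing)
open import Algebra.Core using (Op₁; Op₂)
open import Algebra.Structures using (IsRing; IsCommutativeRing)
open import Algebra.Module.Bundles using (LeftModule)
open import Algebra.Module.Core using (Opₗ)
open import Algebra.Module.Structures using (IsLeftModule)
open import Algebra.Morphism.Structures using (IsRingIsomorphism)
import Algebra.Definitions.RawMonoid as RawMonoidSum
import Algebra.Properties.CommutativeSemigroup as CommutativeSemigroupProperties
import Algebra.Properties.Ring as RingProperties
open import Data.Bool.Base using (Bool; true; false)
open import Data.Fin.Base using (Fin)
open import Data.Nat.Base as ℕ using (ℕ)
import Data.Nat.Properties as ℕ
open import Data.Product.Base using (Σ; ∃-syntax; Σ-syntax; _×_; _,_; proj₁; proj₂)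
open import Data.Rational.Base as ℚ using (ℚ; 0ℚ; 1ℚ; ½)
import Data.Rational.Properties as ℚ
import Data.Rational.Solver as ℚ
open import Relation.Binary.Core using (Rel)
open import Relation.Binary.Structures using (IsEquivalence)
open import Relation.Binary.PropositionalEquality
  using (_≡_; _≢_; refl; sym; trans; cong; subst)

private
  variable
    c ℓ a ℓa b ℓb : Level

-- The real numbers as Cauchy sequences of rationals (the modulus of convergence is part
-- of the data), two sequences being equal when their difference tends to 0.

module Real where

  Cauchy : (ℕ → ℚ) → Set
  Cauchy x = ∀ ε → 0ℚ ℚ.< ε →
    ∃[ N ] ∀ m n → N ℕ.≤ m → N ℕ.≤ n → ℚ.∣ x m ℚ.- x n ∣ ℚ.< ε

  record ℝ : Set where
    constructor mkℝ
    field
      seq    : ℕ → ℚ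
      cauchy : Cauchy seq

  open ℝ public

  infix 4 _≈_
  _≈_ : Rel ℝ 0ℓ
  x ≈ y = ∀ ε → 0ℚ ℚ.< ε →
    ∃[ N ] ∀ n → N ℕ.≤ n → ℚ.∣ seq x n ℚ.- seq y n ∣ ℚ.< ε

  private
    open ℚ.+-*-Solver

    half-pos : ∀ {ε} → 0ℚ ℚ.< ε → 0ℚ ℚ.< ½ ℚ.* ε
    half-pos {ε} ε>0 = subst (ℚ._< ½ ℚ.* ε) (ℚ.*-zeroʳ ½) (ℚ.*-monoʳ-<-pos ½ ε>0)

    halves : ∀ ε → ½ ℚ.* ε ℚ.+ ½ ℚ.* ε ≡ ε
    halves ε = trans (sym (ℚ.*-distribʳ-+ ε ½ ½)) (ℚ.*-identityˡ ε)

    add-close : ∀ {p q r ε} → r ≡ p ℚ.+ q →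
      ℚ.∣ p ∣ ℚ.< ½ ℚ.* ε → ℚ.∣ q ∣ ℚ.< ½ ℚ.* ε → ℚ.∣ r ∣ ℚ.< ε
    add-close {p} {q} {ε = ε} refl p< q< = ℚ.≤-<-trans (ℚ.∣p+q∣≤∣p∣+∣q∣ p q)
      (subst (ℚ.∣ p ∣ ℚ.+ ℚ.∣ q ∣ ℚ.<_) (halves ε) (ℚ.+-mono-< p< q<))

    mul-small : ∀ {p q B δ} → 0ℚ ℚ.< B →
      ℚ.∣ p ∣ ℚ.< B → ℚ.∣ q ∣ ℚ.< δ → ℚ.∣ p ℚ.* q ∣ ℚ.< B ℚ.* δ
    mul-small {p} {q} {B} {δ} B>0 p< q< = subst (ℚ._< B ℚ.* δ) (sym (ℚ.∣p*q∣≡∣p∣*∣q∣ p q))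
      (ℚ.≤-<-trans
        (ℚ.*-monoʳ-≤-nonNeg ℚ.∣ q ∣ {{ℚ.∣-∣-nonNeg q}} (ℚ.<⇒≤ p<))
        (ℚ.*-monoʳ-<-pos B {{ℚ.positive B>0}} q<))

    mul-close : ∀ p q p′ q′ {B δ ε} → 0ℚ ℚ.< B → B ℚ.* δ ≡ ½ ℚ.* ε →
      ℚ.∣ p ∣ ℚ.< B → ℚ.∣ q′ ∣ ℚ.< B →
      ℚ.∣ p ℚ.- p′ ∣ ℚ.< δ → ℚ.∣ q ℚ.- q′ ∣ ℚ.< δ →
      ℚ.∣ p ℚ.* q ℚ.- p′ ℚ.* q′ ∣ ℚ.< ε
    mul-close p q p′ q′ B>0 eq p< q′< dp dq = add-close
      (solve 4 (λ p q p′ q′ →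
        p :* q :- p′ :* q′ := p :* (q :- q′) :+ q′ :* (p :- p′)) refl p q p′ q′)
      (subst (ℚ.∣ p ℚ.* (q ℚ.- q′) ∣ ℚ.<_) eq (mul-small {p} {q ℚ.- q′} B>0 p< dq))
      (subst (ℚ.∣ q′ ℚ.* (p ℚ.- p′) ∣ ℚ.<_) eq (mul-small {q′} {p ℚ.- p′} B>0 q′< dp))

    quotient : ∀ {B ε} → 0ℚ ℚ.< B → 0ℚ ℚ.< ε →
      Σ[ δ ∈ ℚ ] 0ℚ ℚ.< δ × B ℚ.* δ ≡ ½ ℚ.* ε
    quotient {B} {ε} B>0 ε>0 = B⁻¹ ℚ.* (½ ℚ.* ε) , δ>0 , eq
      where
      instance
        B-pos : ℚ.Positive B
        B-pos = ℚ.positive B>0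
        B-nz : ℚ.NonZero B
        B-nz = ℚ.pos⇒nonZero B
      B⁻¹ = ℚ.1/ B
      δ>0 = subst (ℚ._< B⁻¹ ℚ.* (½ ℚ.* ε)) (ℚ.*-zeroʳ B⁻¹)
              (ℚ.*-monoʳ-<-pos B⁻¹ {{ℚ.1/pos⇒pos B}} (half-pos ε>0))
      eq = trans (sym (ℚ.*-assoc B B⁻¹ (½ ℚ.* ε)))
             (trans (cong (ℚ._* (½ ℚ.* ε)) (ℚ.*-inverseʳ B)) (ℚ.*-identityˡ _))

    0<1 : 0ℚ ℚ.< 1ℚ
    0<1 = ℚ.positive⁻¹ 1ℚ

    p<p+q : ∀ p {q} → 0ℚ ℚ.< q → p ℚ.< p ℚ.+ q
    p<p+q p {q} q>0 = subst (ℚ._< p ℚ.+ q) (ℚ.+-identityʳ p) (ℚ.+-monoʳ-< p q>0)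

    p<q+p : ∀ p {q} → 0ℚ ℚ.< q → p ℚ.< q ℚ.+ p
    p<q+p p {q} q>0 = subst (p ℚ.<_) (ℚ.+-comm p q) (p<p+q p q>0)

    bounded : ∀ x → Σ[ B ∈ ℚ ] 0ℚ ℚ.< B × (∃[ N ] ∀ n → N ℕ.≤ n → ℚ.∣ seq x n ∣ ℚ.< B)
    bounded x = ℚ.∣ seq x N ∣ ℚ.+ 1ℚ
              , ℚ.≤-<-trans (ℚ.0≤∣p∣ (seq x N)) (p<p+q _ 0<1)
              , N , below
      where
      N = proj₁ (cauchy x 1ℚ 0<1)
      below : ∀ n → N ℕ.≤ n → ℚ.∣ seq x n ∣ ℚ.< ℚ.∣ seq x N ∣ ℚ.+ 1ℚ
      below n N≤n = subst (λ z → ℚ.∣ z ∣ ℚ.< ℚ.∣ seq x N ∣ ℚ.+ 1ℚ)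
        (solve 2 (λ p q → q :+ (p :- q) := p) refl (seq x n) (seq x N))
        (ℚ.≤-<-trans (ℚ.∣p+q∣≤∣p∣+∣q∣ (seq x N) (seq x n ℚ.- seq x N))
          (ℚ.+-monoʳ-< ℚ.∣ seq x N ∣ (proj₂ (cauchy x 1ℚ 0<1) n N N≤n ℕ.≤-refl)))

    bounded₂ : ∀ x y → Σ[ B ∈ ℚ ] 0ℚ ℚ.< B ×
      (∃[ N ] ∀ n → N ℕ.≤ n → ℚ.∣ seq x n ∣ ℚ.< B × ℚ.∣ seq y n ∣ ℚ.< B)
    bounded₂ x y =
      let B , B>0 , M , x< = bounded x
          C , C>0 , N , y< = bounded y
      in B ℚ.+ C , ℚ.<-trans B>0 (p<p+q B C>0) , M ℕ.⊔ N , λ n le →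
        ( ℚ.<-trans (x< n (ℕ.m⊔n≤o⇒m≤o M N le)) (p<p+q B C>0)
        , ℚ.<-trans (y< n (ℕ.m⊔n≤o⇒n≤o M N le)) (p<q+p C B>0) )

    ∣p-q∣≡∣q-p∣ : ∀ p q → ℚ.∣ p ℚ.- q ∣ ≡ ℚ.∣ q ℚ.- p ∣
    ∣p-q∣≡∣q-p∣ p q = trans (sym (ℚ.∣-p∣≡∣p∣ (p ℚ.- q)))
      (cong ℚ.∣_∣ (solve 2 (λ p q → :- (p :- q) := q :- p) refl p q))

    ∣-p+q∣ : ∀ p q → ℚ.∣ p ℚ.- q ∣ ≡ ℚ.∣ ℚ.- p ℚ.- ℚ.- q ∣
    ∣-p+q∣ p q = trans (sym (ℚ.∣-p∣≡∣p∣ (p ℚ.- q)))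
      (cong ℚ.∣_∣ (solve 2 (λ p q → :- (p :- q) := (:- p) :- (:- q)) refl p q))

    rearrange : ∀ p q r s → (p ℚ.+ q) ℚ.- (r ℚ.+ s) ≡ (p ℚ.- r) ℚ.+ (q ℚ.- s)
    rearrange = solve 4 (λ p q r s → (p :+ q) :- (r :+ s) := (p :- r) :+ (q :- s)) refl

  const : ℚ → ℝ
  const q = mkℝ (λ _ → q) λ ε ε>0 → 0 , λ _ _ _ _ →
    subst (λ z → ℚ.∣ z ∣ ℚ.< ε) (sym (ℚ.+-inverseʳ q)) ε>0

  infixl 6 _+_
  _+_ : Op₂ ℝ
  x + y = mkℝ (λ n → seq x n ℚ.+ seq y n) λ ε ε>0 →
    let M , dx = cauchy x (½ ℚ.* ε) (half-pos ε>0)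
        N , dy = cauchy y (½ ℚ.* ε) (half-pos ε>0)
    in M ℕ.⊔ N , λ m n ≤m ≤n →
      add-close (rearrange (seq x m) (seq y m) (seq x n) (seq y n))
        (dx m n (ℕ.m⊔n≤o⇒m≤o M N ≤m) (ℕ.m⊔n≤o⇒m≤o M N ≤n))
        (dy m n (ℕ.m⊔n≤o⇒n≤o M N ≤m) (ℕ.m⊔n≤o⇒n≤o M N ≤n))

  infix 8 -_
  -_ : Op₁ ℝ
  - x = mkℝ (λ n → ℚ.- seq x n) λ ε ε>0 →
    let N , dx = cauchy x ε ε>0
    in N , λ m n ≤m ≤n → subst (ℚ._< ε) (∣-p+q∣ (seq x m) (seq x n)) (dx m n ≤m ≤n)

  infixl 7 _*_
  _*_ : Op₂ ℝ
  x * y = mkℝ (λ n → seq x n ℚ.* seq y n) λ ε ε>0 →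
    let B , B>0 , L , xy< = bounded₂ x y
        δ , δ>0 , eq = quotient B>0 ε>0
        M , dx = cauchy x δ δ>0
        N , dy = cauchy y δ δ>0
    in L ℕ.⊔ (M ℕ.⊔ N) , λ m n ≤m ≤n →
      let ≤m′ = ℕ.m⊔n≤o⇒n≤o L (M ℕ.⊔ N) ≤m
          ≤n′ = ℕ.m⊔n≤o⇒n≤o L (M ℕ.⊔ N) ≤n
      in mul-close (seq x m) (seq y m) (seq x n) (seq y n) B>0 eq
        (proj₁ (xy< m (ℕ.m⊔n≤o⇒m≤o L (M ℕ.⊔ N) ≤m)))
        (proj₂ (xy< n (ℕ.m⊔n≤o⇒m≤o L (M ℕ.⊔ N) ≤n)))
        (dx m n (ℕ.m⊔n≤o⇒m≤o M N ≤m′) (ℕ.m⊔n≤o⇒m≤o M N ≤n′))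
        (dy m n (ℕ.m⊔n≤o⇒n≤o M N ≤m′) (ℕ.m⊔n≤o⇒n≤o M N ≤n′))

  ≗⇒≈ : ∀ {x y} → (∀ n → seq x n ≡ seq y n) → x ≈ y
  ≗⇒≈ {x} {y} x≗y ε ε>0 = 0 , λ n _ →
    subst (λ z → ℚ.∣ z ∣ ℚ.< ε)
      (sym (trans (cong (ℚ._- seq y n) (x≗y n)) (ℚ.+-inverseʳ (seq y n)))) ε>0

  ≈-isEquivalence : IsEquivalence _≈_
  ≈-isEquivalence = record
    { refl  = λ {x} → ≗⇒≈ {x} {x} (λ _ → refl)
    ; sym   = λ {x} {y} x≈y ε ε>0 →
        let N , d = x≈y ε ε>0
        in N , λ n le → subst (ℚ._< ε) (∣p-q∣≡∣q-p∣ (seq x n) (seq y n)) (d n le)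
    ; trans = λ {x} {y} {z} x≈y y≈z ε ε>0 →
        let M , dx = x≈y (½ ℚ.* ε) (half-pos ε>0)
            N , dy = y≈z (½ ℚ.* ε) (half-pos ε>0)
        in M ℕ.⊔ N , λ n le →
          add-close
            (solve 3 (λ p q r → p :- r := (p :- q) :+ (q :- r)) refl
              (seq x n) (seq y n) (seq z n))
            (dx n (ℕ.m⊔n≤o⇒m≤o M N le))
            (dy n (ℕ.m⊔n≤o⇒n≤o M N le))
    }

  +-cong : ∀ {x x′ y y′} → x ≈ x′ → y ≈ y′ → x + y ≈ x′ + y′
  +-cong {x} {x′} {y} {y′} x≈x′ y≈y′ ε ε>0 =
    let M , dx = x≈x′ (½ ℚ.* ε) (half-pos ε>0)
        N , dy = y≈y′ (½ ℚ.* ε) (half-pos ε>0)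
    in M ℕ.⊔ N , λ n le →
      add-close (rearrange (seq x n) (seq y n) (seq x′ n) (seq y′ n))
        (dx n (ℕ.m⊔n≤o⇒m≤o M N le))
        (dy n (ℕ.m⊔n≤o⇒n≤o M N le))

  -‿cong : ∀ {x x′} → x ≈ x′ → - x ≈ - x′
  -‿cong {x} {x′} x≈x′ ε ε>0 =
    let N , d = x≈x′ ε ε>0
    in N , λ n le → subst (ℚ._< ε) (∣-p+q∣ (seq x n) (seq x′ n)) (d n le)

  *-cong : ∀ {x x′ y y′} → x ≈ x′ → y ≈ y′ → x * y ≈ x′ * y′
  *-cong {x} {x′} {y} {y′} x≈x′ y≈y′ ε ε>0 =
    let B , B>0 , L , xy< = bounded₂ x y′
        δ , δ>0 , eq = quotient B>0 ε>0
        M , dx = x≈x′ δ δ>0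
        N , dy = y≈y′ δ δ>0
    in L ℕ.⊔ (M ℕ.⊔ N) , λ n le →
      let le′ = ℕ.m⊔n≤o⇒n≤o L (M ℕ.⊔ N) le
          x< , y′< = xy< n (ℕ.m⊔n≤o⇒m≤o L (M ℕ.⊔ N) le)
      in mul-close (seq x n) (seq y n) (seq x′ n) (seq y′ n) B>0 eq x< y′<
        (dx n (ℕ.m⊔n≤o⇒m≤o M N le′))
        (dy n (ℕ.m⊔n≤o⇒n≤o M N le′))

  isCommutativeRing : IsCommutativeRing _≈_ _+_ _*_ -_ (const 0ℚ) (const 1ℚ)
  isCommutativeRing = record
    { isRing = record
      { +-isAbelianGroup = record
        { isGroup = record
          { isMonoid = record
            { isSemigroup = record
              { isMagma = record
                { isEquivalence = ≈-isEquivalence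
                ; ∙-cong = λ {x} {x′} {y} {y′} → +-cong {x} {x′} {y} {y′}
                }
              ; assoc = λ x y z → ≗⇒≈ {(x + y) + z} {x + (y + z)} λ n →
                  ℚ.+-assoc (seq x n) (seq y n) (seq z n)
              }
            ; identity = (λ x → ≗⇒≈ {const 0ℚ + x} {x} λ n → ℚ.+-identityˡ (seq x n))
                       , (λ x → ≗⇒≈ {x + const 0ℚ} {x} λ n → ℚ.+-identityʳ (seq x n))
            }
          ; inverse = (λ x → ≗⇒≈ { - x + x} {const 0ℚ} λ n → ℚ.+-inverseˡ (seq x n))
                    , (λ x → ≗⇒≈ {x + - x} {const 0ℚ} λ n → ℚ.+-inverseʳ (seq x n))
          ; ⁻¹-cong = λ {x} {y} → -‿cong {x} {y}
          }
        ; comm = λ x y → ≗⇒≈ {x + y} {y + x} λ n → ℚ.+-comm (seq x n) (seq y n)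
        }
      ; *-cong = λ {x} {x′} {y} {y′} → *-cong {x} {x′} {y} {y′}
      ; *-assoc = λ x y z → ≗⇒≈ {(x * y) * z} {x * (y * z)} λ n →
          ℚ.*-assoc (seq x n) (seq y n) (seq z n)
      ; *-identity = (λ x → ≗⇒≈ {const 1ℚ * x} {x} λ n → ℚ.*-identityˡ (seq x n))
                   , (λ x → ≗⇒≈ {x * const 1ℚ} {x} λ n → ℚ.*-identityʳ (seq x n))
      ; distrib = (λ x y z → ≗⇒≈ {x * (y + z)} {x * y + x * z} λ n →
                      ℚ.*-distribˡ-+ (seq x n) (seq y n) (seq z n))
                , (λ x y z → ≗⇒≈ {(y + z) * x} {y * x + z * x} λ n →
                      ℚ.*-distribʳ-+ (seq x n) (seq y n) (seq z n))
      }
    ; *-comm = λ x y → ≗⇒≈ {x * y} {y * x} λ n → ℚ.*-comm (seq x n) (seq y n)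
    }

ℝ : CommutativeRing 0ℓ 0ℓ
ℝ = record { isCommutativeRing = Real.isCommutativeRing }

-- R[i] = R ⊕ R i with i² = -1.

module Complexification (R : CommutativeRing c ℓ) where

  open CommutativeRing R using ()
    renaming ( Carrier to K; _≈_ to _≈ᴿ_; _+_ to _+ᴿ_; _*_ to _*ᴿ_; -_ to -ᴿ_
             ; 0# to 0ᴿ; 1# to 1ᴿ; _-_ to _-ᴿ_)
  private module R = CommutativeRing R

  record Complex : Set c where
    constructor _+i_
    field
      re im : K

  open Complex public

  infix 4 _≈_
  record _≈_ (z w : Complex) : Set ℓ where
    constructor _,_
    field
      re-≈ : re z ≈ᴿ re w
      im-≈ : im z ≈ᴿ im w

  open _≈_ public

  infixl 6 _+_
  _+_ : Op₂ Complex
  (x +i y) + (u +i v) = (x +ᴿ u) +i (y +ᴿ v)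

  infix 8 -_
  -_ : Op₁ Complex
  - (x +i y) = (-ᴿ x) +i (-ᴿ y)

  infixl 7 _*_
  _*_ : Op₂ Complex
  (x +i y) * (u +i v) = (x *ᴿ u -ᴿ y *ᴿ v) +i (x *ᴿ v +ᴿ y *ᴿ u)

  private
    open RingProperties R.ring using (-0#≈0#; -‿distribˡ-*; -‿distribʳ-*; -‿+-comm)
    open CommutativeSemigroupProperties
      (CommutativeMonoid.commutativeSemigroup R.+-commutativeMonoid) using (interchange)

    x-0y : ∀ x y → x -ᴿ 0ᴿ *ᴿ y ≈ᴿ x
    x-0y x y = R.trans (R.+-congˡ (R.trans (R.-‿cong (R.zeroˡ y)) -0#≈0#)) (R.+-identityʳ x)

    1x+0y : ∀ x y → 1ᴿ *ᴿ x +ᴿ 0ᴿ *ᴿ y ≈ᴿ x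
    1x+0y x y = R.trans (R.+-cong (R.*-identityˡ x) (R.zeroˡ y)) (R.+-identityʳ x)

    *-comm : ∀ z w → z * w ≈ w * z
    *-comm (x +i y) (u +i v) =
      R.+-cong (R.*-comm x u) (R.-‿cong (R.*-comm y v)) ,
      R.trans (R.+-comm (x *ᴿ v) (y *ᴿ u)) (R.+-cong (R.*-comm y u) (R.*-comm x v))

    ≈-trans : ∀ {z w t} → z ≈ w → w ≈ t → z ≈ t
    ≈-trans (p , q) (r , s) = R.trans p r , R.trans q s

    +-cong : ∀ {z z′ w w′} → z ≈ z′ → w ≈ w′ → z + w ≈ z′ + w′
    +-cong (p , q) (r , s) = R.+-cong p r , R.+-cong q s

    *-identityˡ : ∀ z → (1ᴿ +i 0ᴿ) * z ≈ z
    *-identityˡ (x +i y) =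
      R.trans (R.+-congʳ (R.*-identityˡ x)) (x-0y x y) , 1x+0y y x

    *-distribˡ : ∀ z w t → z * (w + t) ≈ z * w + z * t
    *-distribˡ (x +i y) (u +i v) (p +i q) =
      R.trans
        (R.+-cong (R.distribˡ x u p)
          (R.trans (R.-‿cong (R.distribˡ y v q)) (R.sym (-‿+-comm (y *ᴿ v) (y *ᴿ q)))))
        (interchange (x *ᴿ u) (x *ᴿ p) (-ᴿ (y *ᴿ v)) (-ᴿ (y *ᴿ q))) ,
      R.trans (R.+-cong (R.distribˡ x v q) (R.distribˡ y u p))
        (interchange (x *ᴿ v) (x *ᴿ q) (y *ᴿ u) (y *ᴿ p))

    -ᴿ-distribʳ : ∀ x y z → (x -ᴿ y) *ᴿ z ≈ᴿ x *ᴿ z -ᴿ y *ᴿ z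
    -ᴿ-distribʳ x y z = R.trans (R.distribʳ z x (-ᴿ y)) (R.+-congˡ (R.sym (-‿distribˡ-* y z)))

    -ᴿ-distribˡ : ∀ x y z → x *ᴿ (y -ᴿ z) ≈ᴿ x *ᴿ y -ᴿ x *ᴿ z
    -ᴿ-distribˡ x y z = R.trans (R.distribˡ x y (-ᴿ z)) (R.+-congˡ (R.sym (-‿distribʳ-* x z)))

    swap⁺ : ∀ x y u v → (x -ᴿ y) +ᴿ (u +ᴿ v) ≈ᴿ (x +ᴿ u) +ᴿ (v -ᴿ y)
    swap⁺ x y u v = R.trans (interchange x (-ᴿ y) u v) (R.+-congˡ (R.+-comm (-ᴿ y) v))

    swap⁻ : ∀ x y u v → (x -ᴿ y) -ᴿ (u +ᴿ v) ≈ᴿ (x -ᴿ u) -ᴿ (v +ᴿ y)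
    swap⁻ x y u v = R.trans (R.+-congˡ (R.sym (-‿+-comm u v)))
      (R.trans (swap⁺ x y (-ᴿ u) (-ᴿ v)) (R.+-congˡ (-‿+-comm v y)))

    *-assoc : ∀ z w t → (z * w) * t ≈ z * (w * t)
    *-assoc (x +i y) (u +i v) (p +i q) =
      R.trans
        (R.+-cong
          (R.trans (-ᴿ-distribʳ (x *ᴿ u) (y *ᴿ v) p)
            (R.+-cong (R.*-assoc x u p) (R.-‿cong (R.*-assoc y v p))))
          (R.-‿cong (R.trans (R.distribʳ q (x *ᴿ v) (y *ᴿ u))
            (R.+-cong (R.*-assoc x v q) (R.*-assoc y u q)))))
        (R.trans (swap⁻ _ _ _ _)
          (R.sym (R.+-cong (-ᴿ-distribˡ x (u *ᴿ p) (v *ᴿ q))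
            (R.-‿cong (R.distribˡ y (u *ᴿ q) (v *ᴿ p)))))) ,
      R.trans
        (R.+-cong
          (R.trans (-ᴿ-distribʳ (x *ᴿ u) (y *ᴿ v) q)
            (R.+-cong (R.*-assoc x u q) (R.-‿cong (R.*-assoc y v q))))
          (R.trans (R.distribʳ p (x *ᴿ v) (y *ᴿ u))
            (R.+-cong (R.*-assoc x v p) (R.*-assoc y u p))))
        (R.trans (swap⁺ _ _ _ _)
          (R.sym (R.+-cong (R.distribˡ x (u *ᴿ q) (v *ᴿ p))
            (-ᴿ-distribˡ y (u *ᴿ p) (v *ᴿ q)))))

  commutativeRing : CommutativeRing c ℓ
  commutativeRing = record
    { Carrier = Complex ; _≈_ = _≈_ ; _+_ = _+_ ; _*_ = _*_ ; -_ = -_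
    ; 0# = 0ᴿ +i 0ᴿ ; 1# = 1ᴿ +i 0ᴿ
    ; isCommutativeRing = record
      { isRing = record
        { +-isAbelianGroup = record
          { isGroup = record
            { isMonoid = record
              { isSemigroup = record
                { isMagma = record
                  { isEquivalence = record
                    { refl  = R.refl , R.refl
                    ; sym   = λ { (p , q) → R.sym p , R.sym q }
                    ; trans = ≈-trans
                    }
                  ; ∙-cong = +-cong
                  }
                ; assoc = λ z w t →
                    R.+-assoc (re z) (re w) (re t) , R.+-assoc (im z) (im w) (im t)
                }
              ; identity = (λ z → R.+-identityˡ (re z) , R.+-identityˡ (im z))
                         , (λ z → R.+-identityʳ (re z) , R.+-identityʳ (im z))
              }
            ; inverse = (λ z → R.-‿inverseˡ (re z) , R.-‿inverseˡ (im z))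
                      , (λ z → R.-‿inverseʳ (re z) , R.-‿inverseʳ (im z))
            ; ⁻¹-cong = λ { (p , q) → R.-‿cong p , R.-‿cong q }
            }
          ; comm = λ z w → R.+-comm (re z) (re w) , R.+-comm (im z) (im w)
          }
        ; *-cong = λ { (p , q) (r , s) →
            R.+-cong (R.*-cong p r) (R.-‿cong (R.*-cong q s)) ,
            R.+-cong (R.*-cong p s) (R.*-cong q r) }
        ; *-assoc = *-assoc
        ; *-identity = *-identityˡ
                     , (λ z → ≈-trans (*-comm z _) (*-identityˡ z))
        ; distrib = *-distribˡ
                  , (λ z w t → ≈-trans (*-comm (w + t) z)
                      (≈-trans (*-distribˡ z w t) (+-cong (*-comm z w) (*-comm z t))))
        }
      ; *-comm = *-comm
      }
    }

ℂ : CommutativeRing 0ℓ 0ℓ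
ℂ = Complexification.commutativeRing ℝ

record Algebra (K : CommutativeRing c ℓ) a ℓa : Set (c ⊔ ℓ ⊔ suc (a ⊔ ℓa)) where
  private module K = CommutativeRing K

  infix  4 _≈_
  infixl 6 _+_
  infixl 7 _*_
  infixr 7 _•_
  infix  8 -_

  field
    Carrier      : Set a
    _≈_          : Rel Carrier ℓa
    _+_ _*_      : Op₂ Carrier
    -_           : Op₁ Carrier
    0# 1#        : Carrier
    _•_          : Opₗ K.Carrier Carrier
    isRing       : IsRing _≈_ _+_ _*_ -_ 0# 1#
    isLeftModule : IsLeftModule K.ring _≈_ _+_ 0# -_ _•_
    •-*-assoc    : ∀ k x y → (k • x) * y ≈ k • (x * y)
    *-•-comm     : ∀ k x y → x * (k • y) ≈ k • (x * y)

  ring : Ring a ℓa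
  ring = record { isRing = isRing }

  leftModule : LeftModule K.ring a ℓa
  leftModule = record { isLeftModule = isLeftModule }

  Central : Carrier → Set (a ⊔ ℓa)
  Central z = ∀ x → z * x ≈ x * z

-- The centre, as a K-submodule: the only structure its dimension depends on.

module _ {K : CommutativeRing c ℓ} (A : Algebra K a ℓa) where
  private module K = CommutativeRing K
  open Algebra A
  private
    module A = Ring ring
    module M = LeftModule leftModule
  open RingProperties ring using (-‿distribˡ-*; -‿distribʳ-*)

  private
    +-central : ∀ {x y} → Central x → Central y → Central (x + y)
    +-central {x} {y} zx zy w = A.trans (A.distribʳ w x y)
      (A.trans (A.+-cong (zx w) (zy w)) (A.sym (A.distribˡ w x y)))

    0-central : Central 0#
    0-central w = A.trans (A.zeroˡ w) (A.sym (A.zeroʳ w))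

    neg-central : ∀ {x} → Central x → Central (- x)
    neg-central {x} zx w = A.trans (A.sym (-‿distribˡ-* x w))
      (A.trans (A.-‿cong (zx w)) (-‿distribʳ-* w x))

    •-central : ∀ k {x} → Central x → Central (k • x)
    •-central k {x} zx w = A.trans (•-*-assoc k x w)
      (A.trans (M.*ₗ-cong K.refl (zx w)) (A.sym (*-•-comm k w x)))

  centre : LeftModule K.ring (a ⊔ ℓa) ℓa
  centre = record
    { Carrierᴹ = Σ Carrier Central
    ; _≈ᴹ_ = λ (x , _) (y , _) → x ≈ y
    ; _+ᴹ_ = λ (x , zx) (y , zy) → x + y , +-central zx zy
    ; _*ₗ_ = λ k (x , zx) → k • x , •-central k zx
    ; 0ᴹ   = 0# , 0-central
    ; -ᴹ_  = λ (x , zx) → - x , neg-central zx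
    ; isLeftModule = record
      { isLeftSemimodule = record
        { +ᴹ-isCommutativeMonoid = record
          { isMonoid = record
            { isSemigroup = record
              { isMagma = record
                { isEquivalence = record
                  { refl = A.refl ; sym = A.sym ; trans = A.trans }
                ; ∙-cong = A.+-cong
                }
              ; assoc = λ x y z → A.+-assoc (proj₁ x) (proj₁ y) (proj₁ z)
              }
            ; identity = (λ x → A.+-identityˡ (proj₁ x)) , (λ x → A.+-identityʳ (proj₁ x))
            }
          ; comm = λ x y → A.+-comm (proj₁ x) (proj₁ y)
          }
        ; isPreleftSemimodule = record
          { *ₗ-cong      = M.*ₗ-cong
          ; *ₗ-zeroˡ     = λ x → M.*ₗ-zeroˡ (proj₁ x)
          ; *ₗ-distribʳ  = λ x k l → M.*ₗ-distribʳ (proj₁ x) k l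
          ; *ₗ-identityˡ = λ x → M.*ₗ-identityˡ (proj₁ x)
          ; *ₗ-assoc     = λ k l x → M.*ₗ-assoc k l (proj₁ x)
          ; *ₗ-zeroʳ     = M.*ₗ-zeroʳ
          ; *ₗ-distribˡ  = λ k x y → M.*ₗ-distribˡ k (proj₁ x) (proj₁ y)
          }
        }
      ; -ᴹ‿cong    = A.-‿cong
      ; -ᴹ‿inverse = (λ x → A.-‿inverseˡ (proj₁ x)) , (λ x → A.-‿inverseʳ (proj₁ x))
      }
    }

module _ {K : Ring c ℓ} (M : LeftModule K a ℓa) where
  private module K = Ring K
  open LeftModule M
  open RawMonoidSum +ᴹ-rawMonoid using (sum)

  linearCombination : ∀ {d} → (Fin d → K.Carrier) → (Fin d → Carrierᴹ) → Carrierᴹ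
  linearCombination k v = sum (λ i → k i *ₗ v i)

  record IsBasis {d : ℕ} (v : Fin d → Carrierᴹ) : Set (c ⊔ ℓ ⊔ a ⊔ ℓa) where
    field
      independent : ∀ k → linearCombination k v ≈ᴹ 0ᴹ → ∀ i → k i K.≈ K.0#
      spanning    : ∀ x → ∃[ k ] x ≈ᴹ linearCombination k v

  HasDimension : ℕ → Set (c ⊔ ℓ ⊔ a ⊔ ℓa)
  HasDimension d = Σ[ v ∈ (Fin d → Carrierᴹ) ] IsBasis v

record AlgebraIsomorphism {K : CommutativeRing c ℓ}
  (A : Algebra K a ℓa) (B : Algebra K b ℓb) : Set (c ⊔ a ⊔ ℓa ⊔ b ⊔ ℓb) where
  private
    module K = CommutativeRing K
    module A = Algebra A
    module B = Algebra B
  field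
    ⟦_⟧               : A.Carrier → B.Carrier
    isRingIsomorphism : IsRingIsomorphism (Ring.rawRing A.ring) (Ring.rawRing B.ring) ⟦_⟧
    •-homo            : ∀ k x → ⟦ k A.• x ⟧ B.≈ k B.• ⟦ x ⟧

-- The unital associative K-algebra with generators X and relations _∼_:
-- algebra expressions modulo the least congruence containing _∼_ and the algebra axioms.

module Presentation (K : CommutativeRing c ℓ) (X : Set) where
  private module K = CommutativeRing K

  infixl 6 _+_
  infixl 7 _*_
  infixr 7 _•_
  infix  8 -_

  data Expr : Set c where
    gen     : X → Expr
    0# 1#   : Expr
    _+_ _*_ : Expr → Expr → Expr
    -_      : Expr → Expr
    _•_     : K.Carrier → Expr → Expr

  module _ (_∼_ : Rel Expr 0ℓ) where

    infix 4 _≈_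

    data _≈_ : Rel Expr (c ⊔ ℓ) where
      relation     : ∀ {x y} → x ∼ y → x ≈ y

      ≈-refl       : ∀ {x} → x ≈ x
      ≈-sym        : ∀ {x y} → x ≈ y → y ≈ x
      ≈-trans      : ∀ {x y z} → x ≈ y → y ≈ z → x ≈ z

      +-cong       : ∀ {x x′ y y′} → x ≈ x′ → y ≈ y′ → x + y ≈ x′ + y′
      *-cong       : ∀ {x x′ y y′} → x ≈ x′ → y ≈ y′ → x * y ≈ x′ * y′
      -‿cong       : ∀ {x x′} → x ≈ x′ → - x ≈ - x′
      •-cong       : ∀ {k k′ x x′} → k K.≈ k′ → x ≈ x′ → k • x ≈ k′ • x′

      +-assoc      : ∀ x y z → (x + y) + z ≈ x + (y + z)
      +-comm       : ∀ x y → x + y ≈ y + x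
      +-identityˡ  : ∀ x → 0# + x ≈ x
      -‿inverseˡ   : ∀ x → - x + x ≈ 0#

      *-assoc      : ∀ x y z → (x * y) * z ≈ x * (y * z)
      *-identityˡ  : ∀ x → 1# * x ≈ x
      *-identityʳ  : ∀ x → x * 1# ≈ x
      *-distribˡ-+ : ∀ x y z → x * (y + z) ≈ x * y + x * z
      *-distribʳ-+ : ∀ x y z → (y + z) * x ≈ y * x + z * x

      •-identityˡ  : ∀ x → K.1# • x ≈ x
      •-assoc      : ∀ k l x → (k K.* l) • x ≈ k • (l • x)
      •-distribˡ-+ : ∀ k x y → k • (x + y) ≈ k • x + k • y
      •-distribʳ-+ : ∀ x k l → (k K.+ l) • x ≈ k • x + l • x

      •-*-assoc    : ∀ k x y → (k • x) * y ≈ k • (x * y)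
      *-•-comm     : ∀ k x y → x * (k • y) ≈ k • (x * y)

    private
      +-identityʳ : ∀ x → x + 0# ≈ x
      +-identityʳ x = ≈-trans (+-comm x 0#) (+-identityˡ x)

      -‿inverseʳ : ∀ x → x + - x ≈ 0#
      -‿inverseʳ x = ≈-trans (+-comm x (- x)) (-‿inverseˡ x)

      idempotent⇒0 : ∀ {x} → x + x ≈ x → x ≈ 0#
      idempotent⇒0 {x} x+x≈x =
        ≈-trans (≈-sym (+-identityˡ x))
        (≈-trans (+-cong (≈-sym (-‿inverseˡ x)) ≈-refl)
        (≈-trans (+-assoc (- x) x x)
        (≈-trans (+-cong ≈-refl x+x≈x) (-‿inverseˡ x))))

      •-zeroˡ : ∀ x → K.0# • x ≈ 0#
      •-zeroˡ x = idempotent⇒0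
        (≈-trans (≈-sym (•-distribʳ-+ x K.0# K.0#)) (•-cong (K.+-identityˡ K.0#) ≈-refl))

      •-zeroʳ : ∀ k → k • 0# ≈ 0#
      •-zeroʳ k = idempotent⇒0
        (≈-trans (≈-sym (•-distribˡ-+ k 0# 0#)) (•-cong K.refl (+-identityˡ 0#)))

    isRing : IsRing _≈_ _+_ _*_ -_ 0# 1#
    isRing = record
      { +-isAbelianGroup = record
        { isGroup = record
          { isMonoid = record
            { isSemigroup = record
              { isMagma = record
                { isEquivalence = record { refl = ≈-refl ; sym = ≈-sym ; trans = ≈-trans }
                ; ∙-cong = +-cong
                }
              ; assoc = +-assoc
              }
            ; identity = +-identityˡ , +-identityʳ
            }
          ; inverse = -‿inverseˡ , -‿inverseʳ
          ; ⁻¹-cong = -‿cong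
          }
        ; comm = +-comm
        }
      ; *-cong = *-cong
      ; *-assoc = *-assoc
      ; *-identity = *-identityˡ , *-identityʳ
      ; distrib = *-distribˡ-+ , *-distribʳ-+
      }

    algebra : Algebra K c (c ⊔ ℓ)
    algebra = record
      { isRing = isRing
      ; isLeftModule = record
        { isLeftSemimodule = record
          { +ᴹ-isCommutativeMonoid = IsRing.+-isCommutativeMonoid isRing
          ; isPreleftSemimodule = record
            { *ₗ-cong      = •-cong
            ; *ₗ-zeroˡ     = •-zeroˡ
            ; *ₗ-distribʳ  = •-distribʳ-+
            ; *ₗ-identityˡ = •-identityˡ
            ; *ₗ-assoc     = •-assoc
            ; *ₗ-zeroʳ     = •-zeroʳ
            ; *ₗ-distribˡ  = •-distribˡ-+
            }
          }
        ; -ᴹ‿cong    = -‿cong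
        ; -ᴹ‿inverse = -‿inverseˡ , -‿inverseʳ
        }
      ; •-*-assoc = •-*-assoc
      ; *-•-comm  = *-•-comm
      }

record SimpleGraph (n : ℕ) : Set where
  field
    adjacent  : Fin n → Fin n → Bool
    symmetric : ∀ i j → adjacent i j ≡ adjacent j i
    loopless  : ∀ i → adjacent i i ≡ false

module CliffordGraph (K : CommutativeRing c ℓ) {n : ℕ} (G : SimpleGraph n) where
  open SimpleGraph G
  open Presentation K (Fin n)

  data _∼_ : Rel Expr 0ℓ where
    square      : ∀ i → (gen i * gen i) ∼ (- 1#)
    anticommute : ∀ {i j} → i ≢ j → adjacent i j ≡ true →
                  (gen i * gen j) ∼ (- (gen j * gen i))
    commute     : ∀ {i j} → i ≢ j → adjacent i j ≡ false →
                  (gen i * gen j) ∼ (gen j * gen i)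

  cliffordAlgebra : Algebra K c (c ⊔ ℓ)
  cliffordAlgebra = algebra _∼_

CliffordGraphAlgebra : ∀ {n} → SimpleGraph n → Algebra ℂ 0ℓ 0ℓ
CliffordGraphAlgebra G = CliffordGraph.cliffordAlgebra ℂ G

{-# OPTIONS --safe #-}
module Submission where

-- Over ℂ only the commutation signs matter.  Adjacency may be read as an alternating form over 𝔽₂, and the form
-- is put in normal form one vertex or one hyperbolic plane at a time.  If vertex 0 is isolated,
-- e₀ is central with e₀² = -1, so A_G ≅ B × B, where B is the algebra of the remaining graph.
-- If 0 is adjacent to j, the anticommuting pair p = e₀, q = eⱼ generates a copy of M₂(K);
-- multiplying each other generator by one of the involutions 1, i p, i q, i p q makes it commute
-- with p and q, the products again satisfy the relations of some graph on the remaining vertices,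
-- and A_G ≅ M₂(B).  Hence A_G ≅ M_{2^r}(K)^{2^k} with 2r + k = n, whose centre has dimension 2^k,
-- so the dimension of the centre determines k and then r.

open import Defs
open import Level using (Level; _⊔_; 0ℓ)
open import Algebra.Bundles using (CommutativeRing; Ring)
open import Algebra.Module.Bundles using (LeftModule)
open import Algebra.Module.Structures using (IsLeftModule)
import Algebra.Construct.Pointwise as Pointwise
import Algebra.Definitions.RawMonoid as RawMonoidSum
import Algebra.Module.Construct.DirectProduct as DirectProduct
import Algebra.Module.Construct.TensorUnit as TensorUnit
import Algebra.Properties.CommutativeMonoid.Sum as MonoidSum
import Algebra.Properties.CommutativeSemigroup as CommutativeSemigroupProperties
import Algebra.Properties.Ring as RingProperties
open import Data.Bool.Base using (Bool; true; false; not; _∧_; _xor_)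
open import Data.Bool.Properties using (¬-not; xor-comm; xor-same; ∧-comm; ∧-zeroʳ)
  renaming (_≟_ to _≟ᵇ_)
import Data.Bool.Solver as Bool
open import Data.Fin.Base using (Fin; zero; suc; _↑ˡ_; _↑ʳ_; splitAt; join; punchIn; punchOut)
open import Data.Fin.Properties
  using (_≟_; any?; punchIn-punchOut; splitAt-↑ˡ; splitAt-↑ʳ; join-splitAt)
open import Data.Nat.Base as ℕ using (ℕ; zero; suc; _≥_)
open import Data.Nat.Logarithm using (⌊log₂_⌋; ⌊log₂[2^n]⌋≡n)
import Data.Nat.Properties as ℕ
open import Data.Product.Base using (∃-syntax; _×_; _,_; proj₁; proj₂)
open import Data.Rational.Base as ℚ using (ℚ; 0ℚ; 1ℚ)
import Data.Rational.Properties as ℚ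
open import Data.Sum.Base using (_⊎_; inj₁; inj₂; [_,_]′)
open import Data.Vec.Functional using (insertAt)
open import Data.Vec.Functional.Properties using (insertAt-lookup; insertAt-punchIn)
open import Function.Base using (_∘_; const)
open import Relation.Binary.Core using (Rel)
open import Relation.Binary.Definitions using (tri<; tri≈; tri>)
open import Relation.Binary.PropositionalEquality as ≡ using (_≡_)
import Relation.Binary.Reasoning.Setoid as SetoidReasoning
open import Relation.Nullary using (yes; no; contradiction)

-- The two scalars do different jobs: `ι` turns an element of square -1 into an involution, and `½`
-- turns an involution into two complementary idempotents.
--
-- The involution attached to a remaining generator is the one with the same signs `s`, `t` against
-- `p` and `q`. It commutes with that generator because `s t + t s = 0` over 𝔽₂, so the product
-- again squares to -1. The new adjacency is the Schur complement of the plane of `e₀` and `eⱼ`,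
-- that is, the form on its orthogonal complement.
--
-- Expressions modulo the relations come without a normal form, so each isomorphism is built from
-- universal properties: homomorphisms in both directions, one composite compared with the identity
-- on generators, the other by splitting an element of B × B or M₂(B) into coefficients times
-- idempotents or matrix units.
--
-- Equality of Cauchy sequences cannot be decided, so invariance of dimension cannot rest on
-- elimination with pivots. It comes from comparing traces, and this is where characteristic zero
-- enters.

private
  variable
    c ℓ a ℓa b ℓb d ℓd : Level

module _ {K : Ring c ℓ} where

  private module K = Ring K

  -- Bases and dimension

  module LinearCombination (M : LeftModule K a ℓa) where
    open LeftModule M
    open MonoidSum +ᴹ-commutativeMonoid public
      using (sum; sum-cong-≋; ∑-distrib-+; ∑-comm; sum-replicate-zero)
    open SetoidReasoning ≈ᴹ-setoid

    private module ΣK = MonoidSum K.+-commutativeMonoid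

    lc : ∀ {n} → (Fin n → K.Carrier) → (Fin n → Carrierᴹ) → Carrierᴹ
    lc = linearCombination M

    lc-cong : ∀ {n} {k l : Fin n → K.Carrier} {v w} →
              (∀ i → k i K.≈ l i) → (∀ i → v i ≈ᴹ w i) → lc k v ≈ᴹ lc l w
    lc-cong k≈l v≈w = sum-cong-≋ λ i → *ₗ-cong (k≈l i) (v≈w i)

    *ₗ-distrib-sum : ∀ {n} k (v : Fin n → Carrierᴹ) → k *ₗ sum v ≈ᴹ sum (λ i → k *ₗ v i)
    *ₗ-distrib-sum {zero}  k v = *ₗ-zeroʳ k
    *ₗ-distrib-sum {suc n} k v =
      ≈ᴹ-trans (*ₗ-distribˡ k (v zero) _) (+ᴹ-congˡ (*ₗ-distrib-sum k (v ∘ suc)))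

    sum-distrib-*ₗ : ∀ {n} (k : Fin n → K.Carrier) x → ΣK.sum k *ₗ x ≈ᴹ sum (λ i → k i *ₗ x)
    sum-distrib-*ₗ {zero}  k x = *ₗ-zeroˡ x
    sum-distrib-*ₗ {suc n} k x =
      ≈ᴹ-trans (*ₗ-distribʳ x (k zero) _) (+ᴹ-congˡ (sum-distrib-*ₗ (k ∘ suc) x))

    -- Substituting one family into another multiplies coefficients by the matrix `P`. Applied to
    -- two bases, this exhibits the product of the two change-of-basis matrices.
    lc-lc : ∀ {m n} (k : Fin m → K.Carrier) (P : Fin m → Fin n → K.Carrier) v →
            lc k (λ i → lc (P i) v) ≈ᴹ lc (λ j → ΣK.sum (λ i → k i K.* P i j)) v
    lc-lc k P v = begin
      sum (λ i → k i *ₗ sum (λ j → P i j *ₗ v j))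
        ≈⟨ sum-cong-≋ (λ i → *ₗ-distrib-sum (k i) (λ j → P i j *ₗ v j)) ⟩
      sum (λ i → sum (λ j → k i *ₗ P i j *ₗ v j))
        ≈⟨ ∑-comm (λ i j → k i *ₗ P i j *ₗ v j) ⟩
      sum (λ j → sum (λ i → k i *ₗ P i j *ₗ v j))
        ≈⟨ sum-cong-≋ (λ j → sum-cong-≋ λ i → *ₗ-assoc (k i) (P i j) (v j)) ⟨
      sum (λ j → sum (λ i → (k i K.* P i j) *ₗ v j))
        ≈⟨ sum-cong-≋ (λ j → sum-distrib-*ₗ (λ i → k i K.* P i j) (v j)) ⟨
      sum (λ j → ΣK.sum (λ i → k i K.* P i j) *ₗ v j) ∎

    lc-0 : ∀ {n} (v : Fin n → Carrierᴹ) → lc (λ _ → K.0#) v ≈ᴹ 0ᴹ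
    lc-0 {n} v = ≈ᴹ-trans (sum-cong-≋ λ i → *ₗ-zeroˡ (v i)) (sum-replicate-zero n)

    unit : ∀ {n} → Fin n → Fin n → K.Carrier
    unit zero    zero    = K.1#
    unit zero    (suc j) = K.0#
    unit (suc i) zero    = K.0#
    unit (suc i) (suc j) = unit i j

    unit-refl : ∀ {n} (i : Fin n) → unit i i ≡ K.1#
    unit-refl zero    = ≡.refl
    unit-refl (suc i) = unit-refl i

    lc-unit : ∀ {n} i (v : Fin n → Carrierᴹ) → lc (unit i) v ≈ᴹ v i
    lc-unit zero v =
      ≈ᴹ-trans (+ᴹ-cong (*ₗ-identityˡ (v zero)) (lc-0 (v ∘ suc))) (+ᴹ-identityʳ (v zero))
    lc-unit (suc i) v =
      ≈ᴹ-trans (+ᴹ-cong (*ₗ-zeroˡ (v zero)) (lc-unit i (v ∘ suc))) (+ᴹ-identityˡ (v (suc i)))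

    lc-+ : ∀ {n} (k l : Fin n → K.Carrier) v →
           lc (λ i → k i K.+ l i) v ≈ᴹ lc k v +ᴹ lc l v
    lc-+ k l v = ≈ᴹ-trans (sum-cong-≋ λ i → *ₗ-distribʳ (v i) (k i) (l i))
                          (∑-distrib-+ (λ i → k i *ₗ v i) (λ i → l i *ₗ v i))

    module Basis {n} {v : Fin n → Carrierᴹ} (v-basis : IsBasis M v) where
      open IsBasis v-basis

      coordinates-unique : ∀ {k l} → lc k v ≈ᴹ lc l v → ∀ i → k i K.≈ l i
      coordinates-unique {k} {l} eq i =
        x∙y⁻¹≈ε⇒x≈y (k i) (l i) (independent (λ j → k j K.- l j) difference i)
        where
        open RingProperties K using (x∙y⁻¹≈ε⇒x≈y)
        difference : lc (λ j → k j K.- l j) v ≈ᴹ 0ᴹ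
        difference = ≈ᴹ-trans (lc-+ k (λ j → K.- l j) v) (≈ᴹ-trans (+ᴹ-congʳ eq)
          (≈ᴹ-trans (≈ᴹ-sym (lc-+ l (λ j → K.- l j) v))
          (≈ᴹ-trans (lc-cong (λ j → K.-‿inverseʳ (l j)) (λ _ → ≈ᴹ-refl)) (lc-0 v))))

      coordinates : Carrierᴹ → Fin n → K.Carrier
      coordinates x = proj₁ (spanning x)

  -- Linear bijections, and bases of direct sums

  record LinearBijection (M : LeftModule K a ℓa) (N : LeftModule K b ℓb) :
                         Set (c ⊔ a ⊔ ℓa ⊔ b ⊔ ℓb) where
    private
      module M = LeftModule M
      module N = LeftModule N
    field
      ⟦_⟧        : M.Carrierᴹ → N.Carrierᴹ
      cong       : ∀ {x y} → x M.≈ᴹ y → ⟦ x ⟧ N.≈ᴹ ⟦ y ⟧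
      +-homo     : ∀ x y → ⟦ x M.+ᴹ y ⟧ N.≈ᴹ ⟦ x ⟧ N.+ᴹ ⟦ y ⟧
      •-homo     : ∀ k x → ⟦ k M.*ₗ x ⟧ N.≈ᴹ k N.*ₗ ⟦ x ⟧
      injective  : ∀ {x y} → ⟦ x ⟧ N.≈ᴹ ⟦ y ⟧ → x M.≈ᴹ y
      surjective : ∀ y → ∃[ x ] y N.≈ᴹ ⟦ x ⟧

  module _ {M : LeftModule K a ℓa} {N : LeftModule K b ℓb} (f : LinearBijection M N) where
    private
      module M = LeftModule M
      module N = LeftModule N
    open LinearBijection f

    0-homo : ⟦ M.0ᴹ ⟧ N.≈ᴹ N.0ᴹ
    0-homo = N.≈ᴹ-trans (cong (M.≈ᴹ-sym (M.*ₗ-zeroʳ K.0#)))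
               (N.≈ᴹ-trans (•-homo K.0# M.0ᴹ) (N.*ₗ-zeroˡ ⟦ M.0ᴹ ⟧))

    lc-homo : ∀ {n} (k : Fin n → K.Carrier) v →
              ⟦ linearCombination M k v ⟧ N.≈ᴹ linearCombination N k (⟦_⟧ ∘ v)
    lc-homo {zero}  k v = 0-homo
    lc-homo {suc n} k v = N.≈ᴹ-trans (+-homo _ _)
      (N.+ᴹ-cong (•-homo (k zero) (v zero)) (lc-homo (k ∘ suc) (v ∘ suc)))

    dimension-transport : ∀ {n} → HasDimension M n → HasDimension N n
    dimension-transport (v , v-basis) = ⟦_⟧ ∘ v , record
      { independent = λ k eq → independent k
          (injective (N.≈ᴹ-trans (lc-homo k v) (N.≈ᴹ-trans eq (N.≈ᴹ-sym 0-homo))))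
      ; spanning = λ y →
          let x , y≈fx = surjective y
              k , x≈kv = spanning x
          in k , N.≈ᴹ-trans y≈fx (N.≈ᴹ-trans (cong x≈kv) (lc-homo k v))
      }
      where open IsBasis v-basis

  module _ (M : LeftModule K a ℓa) (N : LeftModule K b ℓb) where
    private
      module M = LeftModule M
      module N = LeftModule N
      module LM = LinearCombination M
      module LN = LinearCombination N
      _⊕_ = DirectProduct.leftModule
      M⊕N = M ⊕ N
      module ⊕ = LeftModule M⊕N
      lc = linearCombination M⊕N

    lc-split : ∀ {m n} (k : Fin (m ℕ.+ n) → K.Carrier) v →
      lc k v ⊕.≈ᴹ lc (k ∘ (_↑ˡ n)) (v ∘ (_↑ˡ n)) ⊕.+ᴹ lc (k ∘ (m ↑ʳ_)) (v ∘ (m ↑ʳ_))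
    lc-split {zero}  k v = ⊕.≈ᴹ-sym (⊕.+ᴹ-identityˡ _)
    lc-split {suc m} k v = ⊕.≈ᴹ-trans (⊕.+ᴹ-congˡ (lc-split {m} (k ∘ suc) (v ∘ suc)))
      (⊕.≈ᴹ-sym (⊕.+ᴹ-assoc _ _ _))

    lc-fst : ∀ {m} (k : Fin m → K.Carrier) v →
      lc k (λ i → v i , N.0ᴹ) ⊕.≈ᴹ (linearCombination M k v , N.0ᴹ)
    lc-fst {zero}  k v = ⊕.≈ᴹ-refl
    lc-fst {suc m} k v = ⊕.≈ᴹ-trans (⊕.+ᴹ-congˡ (lc-fst (k ∘ suc) (v ∘ suc)))
      (M.≈ᴹ-refl , N.≈ᴹ-trans (N.+ᴹ-identityʳ _) (N.*ₗ-zeroʳ (k zero)))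

    lc-snd : ∀ {n} (k : Fin n → K.Carrier) w →
      lc k (λ j → M.0ᴹ , w j) ⊕.≈ᴹ (M.0ᴹ , linearCombination N k w)
    lc-snd {zero}  k w = ⊕.≈ᴹ-refl
    lc-snd {suc n} k w = ⊕.≈ᴹ-trans (⊕.+ᴹ-congˡ (lc-snd (k ∘ suc) (w ∘ suc)))
      (M.≈ᴹ-trans (M.+ᴹ-identityʳ _) (M.*ₗ-zeroʳ (k zero)) , N.≈ᴹ-refl)

    -- The joint family lists the `v i , 0` before the `0 , w j`. A combination of it is the pair of
    -- the two partial combinations, so both basis conditions can be read off componentwise.
    dimension-⊕ : ∀ {m n} → HasDimension M m → HasDimension N n → HasDimension M⊕N (m ℕ.+ n)
    dimension-⊕ {m} {n} (v , v-basis) (w , w-basis) = vw , record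
      { independent = independent
      ; spanning    = λ (x , y) →
          let k , x≈kv = V.spanning x
              l , y≈lw = W.spanning y
              kl = [ k , l ]′ ∘ splitAt m
          in kl , ⊕.≈ᴹ-trans
               ( M.≈ᴹ-trans x≈kv (LM.lc-cong
                   (λ i → K.reflexive (≡.cong [ k , l ]′ (≡.sym (splitAt-↑ˡ m i n)))) (λ _ → M.≈ᴹ-refl))
               , N.≈ᴹ-trans y≈lw (LN.lc-cong
                   (λ j → K.reflexive (≡.cong [ k , l ]′ (≡.sym (splitAt-↑ʳ m n j)))) (λ _ → N.≈ᴹ-refl)) )
               (⊕.≈ᴹ-sym (combination kl))
      }
      where
      module V = IsBasis v-basis
      module W = IsBasis w-basis
      vw : Fin (m ℕ.+ n) → ⊕.Carrierᴹ
      vw = [ (λ i → v i , N.0ᴹ) , (λ j → M.0ᴹ , w j) ]′ ∘ splitAt m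
      combination : ∀ k → lc k vw ⊕.≈ᴹ
        (linearCombination M (k ∘ (_↑ˡ n)) v , linearCombination N (k ∘ (m ↑ʳ_)) w)
      combination k = ⊕.≈ᴹ-trans (lc-split {m} k vw)
        (⊕.≈ᴹ-trans (⊕.+ᴹ-cong
           (⊕.≈ᴹ-trans (L⊕.lc-cong (λ _ → K.refl)
             (λ i → ⊕.≈ᴹ-reflexive (≡.cong [ _ , _ ]′ (splitAt-↑ˡ m i n)))) (lc-fst (k ∘ (_↑ˡ n)) v))
           (⊕.≈ᴹ-trans (L⊕.lc-cong (λ _ → K.refl)
             (λ j → ⊕.≈ᴹ-reflexive (≡.cong [ _ , _ ]′ (splitAt-↑ʳ m n j)))) (lc-snd (k ∘ (m ↑ʳ_)) w)))
         (M.+ᴹ-identityʳ _ , N.+ᴹ-identityˡ _))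
        where module L⊕ = LinearCombination M⊕N
      independent : ∀ k → lc k vw ⊕.≈ᴹ ⊕.0ᴹ → ∀ i → k i K.≈ K.0#
      -- Each index is the `join` of its `splitAt`, which leaves one case for each summand.
      independent k eq i = ≡.subst (λ i → k i K.≈ K.0#) (join-splitAt m n i) (vanish (splitAt m i))
        where
        kv≈0 = ⊕.≈ᴹ-trans (⊕.≈ᴹ-sym (combination k)) eq
        vanish : ∀ s → k (join m n s) K.≈ K.0#
        vanish (inj₁ i) = V.independent (k ∘ (_↑ˡ n)) (proj₁ kv≈0) i
        vanish (inj₂ j) = W.independent (k ∘ (m ↑ʳ_)) (proj₂ kv≈0) j

module _ {K : CommutativeRing c ℓ} where

  private module K = CommutativeRing K

  -- Stated as injectivity of the map from ℕ to `K`, since the traces of two identity matrices are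
  -- compared as elements of `K` and their sizes must be recovered.
  CharacteristicZero : Set ℓ
  CharacteristicZero = ∀ m n → m ×ᴷ K.1# K.≈ n ×ᴷ K.1# → m ≡ n
    where open RawMonoidSum K.+-rawMonoid renaming (_×_ to _×ᴷ_)

  -- If P and Q are the two matrices of a change of basis, then P Q and Q P are identity
  -- matrices of sizes m and n, and both traces equal Σᵢⱼ Pᵢⱼ Qⱼᵢ.
  dimension-unique : CharacteristicZero → {M : LeftModule K.ring a ℓa} → ∀ {m n} →
                     HasDimension M m → HasDimension M n → m ≡ n
  dimension-unique char0 {M} {m} {n} (v , v-basis) (w , w-basis) = char0 m n (begin
    m ×ᴷ K.1#                                    ≈⟨ trace v-basis w-basis ⟨
    sum (λ i → sum (λ j → P i j K.* Q j i))      ≈⟨ ∑-comm (λ i j → P i j K.* Q j i) ⟩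
    sum (λ j → sum (λ i → P i j K.* Q j i))
      ≈⟨ sum-cong-≋ (λ j → sum-cong-≋ λ i → K.*-comm (P i j) (Q j i)) ⟩
    sum (λ j → sum (λ i → Q j i K.* P i j))      ≈⟨ trace w-basis v-basis ⟩
    n ×ᴷ K.1#                                    ∎)
    where
    open LeftModule M
    open RawMonoidSum K.+-rawMonoid using () renaming (_×_ to _×ᴷ_)
    open MonoidSum K.+-commutativeMonoid using (sum; sum-cong-≋; ∑-comm; sum-replicate)
    open LinearCombination M hiding (sum; sum-cong-≋; ∑-comm)
    open SetoidReasoning K.setoid
    P : Fin m → Fin n → K.Carrier
    P i = Basis.coordinates w-basis (v i)
    Q : Fin n → Fin m → K.Carrier
    Q j = Basis.coordinates v-basis (w j)
    trace : ∀ {m n} {v : Fin m → Carrierᴹ} {w : Fin n → Carrierᴹ}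
            (v-basis : IsBasis M v) (w-basis : IsBasis M w) →
            sum (λ i → sum λ j →
              Basis.coordinates w-basis (v i) j K.* Basis.coordinates v-basis (w j) i)
              K.≈ m ×ᴷ K.1#
    trace {m} {n} {v} {w} v-basis w-basis = K.trans (sum-cong-≋ diagonal) (sum-replicate m)
      where
      module V = IsBasis v-basis
      module W = IsBasis w-basis
      -- Row `i` of the product of the two coordinate matrices and `unit i` are both coordinates of
      -- `v i` in the basis `v`, so they agree.
      expand : ∀ i → lc (λ k → sum (λ j → proj₁ (W.spanning (v i)) j K.* proj₁ (V.spanning (w j)) k)) v
                       ≈ᴹ lc (unit i) v
      expand i = ≈ᴹ-trans (≈ᴹ-sym (lc-lc (proj₁ (W.spanning (v i))) _ v))
        (≈ᴹ-trans (lc-cong (λ _ → K.refl) (λ j → ≈ᴹ-sym (proj₂ (V.spanning (w j)))))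
        (≈ᴹ-trans (≈ᴹ-sym (proj₂ (W.spanning (v i)))) (≈ᴹ-sym (lc-unit i v))))
      diagonal : ∀ i → sum (λ j → proj₁ (W.spanning (v i)) j K.* proj₁ (V.spanning (w j)) i) K.≈ K.1#
      diagonal i = K.trans (Basis.coordinates-unique v-basis (expand i) i) (K.reflexive (unit-refl i))

module _ {K : CommutativeRing c ℓ} where

  private module K = CommutativeRing K

  -- Commutation up to sign, idempotents and matrix units

  module AlgebraReasoning (A : Algebra K a ℓa) where
    open Algebra A public
    open Ring ring public using
      ( setoid; refl; sym; trans; reflexive; +-assoc; +-comm; +-identityˡ; +-identityʳ
      ; +-cong; +-congˡ; +-congʳ; -‿cong; -‿inverseˡ; -‿inverseʳ; *-assoc; *-identityˡ; *-identityʳ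
      ; *-cong; *-congˡ; *-congʳ; distribˡ; distribʳ; zeroˡ; zeroʳ )
    open RingProperties ring public using
      ( -0#≈0#; -‿involutive; -‿+-comm; -‿distribˡ-*; -‿distribʳ-*; +-inverseˡ-unique
      ; x[y-z]≈xy-xz; [y-z]x≈yx-zx )
    open CommutativeSemigroupProperties (Ring.+-commutativeSemigroup ring) public
      using () renaming (interchange to +-interchange)
    open LeftModule leftModule public using () renaming
      ( *ₗ-cong to •-cong; *ₗ-zeroˡ to •-zeroˡ; *ₗ-zeroʳ to •-zeroʳ; *ₗ-assoc to •-assoc
      ; *ₗ-identityˡ to •-identityˡ; *ₗ-distribˡ to •-distribˡ; *ₗ-distribʳ to •-distribʳ )
    open SetoidReasoning setoid public

    •-congˡ : ∀ {k x y} → x ≈ y → k • x ≈ k • y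
    •-congˡ = •-cong K.refl

    •-neg : ∀ k x → k • (- x) ≈ - (k • x)
    •-neg k x = +-inverseˡ-unique _ _ (trans (sym (•-distribˡ k (- x) x))
      (trans (•-congˡ (-‿inverseˡ x)) (•-zeroʳ k)))

    neg-• : ∀ k x → (K.- k) • x ≈ - (k • x)
    neg-• k x = +-inverseˡ-unique _ _ (trans (sym (•-distribʳ x (K.- k) k))
      (trans (•-cong (K.-‿inverseˡ k) refl) (•-zeroˡ x)))

    neg-*-neg : ∀ x y → (- x) * (- y) ≈ x * y
    neg-*-neg x y = trans (sym (-‿distribˡ-* x (- y)))
      (trans (-‿cong (sym (-‿distribʳ-* x y))) (-‿involutive (x * y)))

    swap-middle : ∀ x y z w → y * z ≈ z * y → (x * y) * (z * w) ≈ (x * z) * (y * w)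
    swap-middle x y z w yz≈zy = begin
      (x * y) * (z * w)  ≈⟨ *-assoc x y (z * w) ⟩
      x * (y * (z * w))  ≈⟨ *-congˡ (*-assoc y z w) ⟨
      x * ((y * z) * w)  ≈⟨ *-congˡ (*-congʳ yz≈zy) ⟩
      x * ((z * y) * w)  ≈⟨ *-congˡ (*-assoc z y w) ⟩
      x * (z * (y * w))  ≈⟨ *-assoc x z (y * w) ⟨
      (x * z) * (y * w)  ∎

    -- Signs are Booleans, with `true` for minus: adjacency is then itself a commutation sign, and
    -- signs multiply by `_xor_`.
    sgn : Bool → Carrier → Carrier
    sgn false x = x
    sgn true  x = - x

    sgn-cong : ∀ s {x y} → x ≈ y → sgn s x ≈ sgn s y
    sgn-cong false x≈y = x≈y
    sgn-cong true  x≈y = -‿cong x≈y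

    sgn-xor : ∀ s t x → sgn s (sgn t x) ≈ sgn (s xor t) x
    sgn-xor false t     x = refl
    sgn-xor true  false x = refl
    sgn-xor true  true  x = -‿involutive x

    sgn-involutive : ∀ s x → sgn s (sgn s x) ≈ x
    sgn-involutive false x = refl
    sgn-involutive true  x = -‿involutive x

    sgn-comm : ∀ s t x → sgn s (sgn t x) ≈ sgn t (sgn s x)
    sgn-comm s t x = trans (sgn-xor s t x)
      (trans (reflexive (≡.cong (λ r → sgn r x) (xor-comm s t))) (sym (sgn-xor t s x)))

    sgn-*ˡ : ∀ s x y → sgn s x * y ≈ sgn s (x * y)
    sgn-*ˡ false x y = refl
    sgn-*ˡ true  x y = sym (-‿distribˡ-* x y)

    sgn-*ʳ : ∀ s x y → x * sgn s y ≈ sgn s (x * y)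
    sgn-*ʳ false x y = refl
    sgn-*ʳ true  x y = sym (-‿distribʳ-* x y)

    sgn-• : ∀ s k x → k • sgn s x ≈ sgn s (k • x)
    sgn-• false k x = refl
    sgn-• true  k x = •-neg k x

    sgn-+ : ∀ s x y → sgn s (x + y) ≈ sgn s x + sgn s y
    sgn-+ false x y = refl
    sgn-+ true  x y = sym (-‿+-comm x y)

    -- x y = ± y x, with sign - for s = true; a record, so that x, s and y can be inferred from it.
    infix 4 _⋈[_]_
    record _⋈[_]_ (x : Carrier) (s : Bool) (y : Carrier) : Set ℓa where
      constructor mk⋈
      field swap : x * y ≈ sgn s (y * x)

    open _⋈[_]_ public

    ⋈-cong : ∀ {x x′ s y y′} → x ≈ x′ → y ≈ y′ → x ⋈[ s ] y → x′ ⋈[ s ] y′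
    ⋈-cong {s = s} x≈x′ y≈y′ x⋈y = mk⋈ (trans (sym (*-cong x≈x′ y≈y′))
      (trans (swap x⋈y) (sgn-cong s (*-cong y≈y′ x≈x′))))

    ⋈-resp : ∀ {x s t y} → s ≡ t → x ⋈[ s ] y → x ⋈[ t ] y
    ⋈-resp ≡.refl x⋈y = x⋈y

    ⋈-refl : ∀ x → x ⋈[ false ] x
    ⋈-refl x = mk⋈ refl

    ⋈-sym : ∀ {x s y} → x ⋈[ s ] y → y ⋈[ s ] x
    ⋈-sym {x} {s} {y} x⋈y = mk⋈
      (trans (sym (sgn-involutive s (y * x))) (sgn-cong s (sym (swap x⋈y))))

    ⋈-1 : ∀ x → x ⋈[ false ] 1#
    ⋈-1 x = mk⋈ (trans (*-identityʳ x) (sym (*-identityˡ x)))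

    -- Moving `x` past `y` and then past `z` multiplies the signs. This is the bilinearity over 𝔽₂
    -- of the commutation form.
    ⋈-* : ∀ {x s y t z} → x ⋈[ s ] y → x ⋈[ t ] z → x ⋈[ s xor t ] y * z
    ⋈-* {x} {s} {y} {t} {z} x⋈y x⋈z = mk⋈ (begin
      x * (y * z)                  ≈⟨ *-assoc x y z ⟨
      (x * y) * z                  ≈⟨ *-congʳ (swap x⋈y) ⟩
      sgn s (y * x) * z            ≈⟨ sgn-*ˡ s (y * x) z ⟩
      sgn s (y * x * z)            ≈⟨ sgn-cong s (*-assoc y x z) ⟩
      sgn s (y * (x * z))          ≈⟨ sgn-cong s (*-congˡ (swap x⋈z)) ⟩
      sgn s (y * sgn t (z * x))    ≈⟨ sgn-cong s (sgn-*ʳ t y (z * x)) ⟩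
      sgn s (sgn t (y * (z * x)))  ≈⟨ sgn-xor s t _ ⟩
      sgn (s xor t) (y * (z * x))  ≈⟨ sgn-cong (s xor t) (*-assoc y z x) ⟨
      sgn (s xor t) (y * z * x)    ∎)

    ⋈-+ : ∀ {x s y z} → x ⋈[ s ] y → x ⋈[ s ] z → x ⋈[ s ] y + z
    ⋈-+ {x} {s} {y} {z} x⋈y x⋈z = mk⋈ (trans (distribˡ x y z) (trans (+-cong (swap x⋈y) (swap x⋈z))
      (trans (sym (sgn-+ s (y * x) (z * x))) (sgn-cong s (sym (distribʳ x y z))))))

    ⋈-• : ∀ k {x s y} → x ⋈[ s ] y → x ⋈[ s ] k • y
    ⋈-• k {x} {s} {y} x⋈y = mk⋈ (trans (*-•-comm k x y) (trans (•-congˡ (swap x⋈y))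
      (trans (sgn-• s k (y * x)) (sgn-cong s (sym (•-*-assoc k y x))))))

    ⋈-sgn : ∀ r {x s y} → x ⋈[ s ] y → x ⋈[ s ] sgn r y
    ⋈-sgn r {x} {s} {y} x⋈y = mk⋈ (trans (sgn-*ʳ r x y) (trans (sgn-cong r (swap x⋈y))
      (trans (sgn-comm r s (y * x)) (sgn-cong s (sym (sgn-*ˡ r y x))))))

    square-* : ∀ {x s y} → y ⋈[ s ] x → (x * y) * (x * y) ≈ sgn s ((x * x) * (y * y))
    square-* {x} {s} {y} y⋈x = begin
      (x * y) * (x * y)         ≈⟨ *-assoc x y (x * y) ⟩
      x * (y * (x * y))         ≈⟨ *-congˡ (*-assoc y x y) ⟨
      x * ((y * x) * y)         ≈⟨ *-congˡ (*-congʳ (swap y⋈x)) ⟩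
      x * (sgn s (x * y) * y)   ≈⟨ *-congˡ (sgn-*ˡ s (x * y) y) ⟩
      x * sgn s (x * y * y)     ≈⟨ sgn-*ʳ s x _ ⟩
      sgn s (x * (x * y * y))   ≈⟨ sgn-cong s (*-congˡ (*-assoc x y y)) ⟩
      sgn s (x * (x * (y * y))) ≈⟨ sgn-cong s (*-assoc x x (y * y)) ⟨
      sgn s ((x * x) * (y * y)) ∎

    -- The Kronecker symbol times `x`, encoded as a choice between `x` and `0#` so that it computes
    -- once the indices are known.
    δ : Bool → Bool → Carrier → Carrier
    δ false false x = x
    δ false true  x = 0#
    δ true  false x = 0#
    δ true  true  x = x

    δ-cong : ∀ i j {x y} → x ≈ y → δ i j x ≈ δ i j y
    δ-cong false false x≈y = x≈y
    δ-cong false true  x≈y = refl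
    δ-cong true  false x≈y = refl
    δ-cong true  true  x≈y = x≈y

    δ-*ˡ : ∀ i j x y → x * δ i j y ≈ δ i j (x * y)
    δ-*ˡ false false x y = refl
    δ-*ˡ false true  x y = zeroʳ x
    δ-*ˡ true  false x y = zeroʳ x
    δ-*ˡ true  true  x y = refl

    δ-*ʳ : ∀ i j x y → δ i j x * y ≈ δ i j (x * y)
    δ-*ʳ false false x y = refl
    δ-*ʳ false true  x y = zeroˡ y
    δ-*ʳ true  false x y = zeroˡ y
    δ-*ʳ true  true  x y = refl

    δ-sym : ∀ i j x → δ i j x ≡ δ j i x
    δ-sym false false x = ≡.refl
    δ-sym false true  x = ≡.refl
    δ-sym true  false x = ≡.refl
    δ-sym true  true  x = ≡.refl

    δ-+ : ∀ i j x y → δ i j (x + y) ≈ δ i j x + δ i j y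
    δ-+ false false x y = refl
    δ-+ false true  x y = sym (+-identityˡ 0#)
    δ-+ true  false x y = sym (+-identityˡ 0#)
    δ-+ true  true  x y = refl

    δ-• : ∀ i j k x → δ i j (k • x) ≈ k • δ i j x
    δ-• false false k x = refl
    δ-• false true  k x = sym (•-zeroʳ k)
    δ-• true  false k x = sym (•-zeroʳ k)
    δ-• true  true  k x = refl

    δ-comm : ∀ i j k l x → δ i j (δ k l x) ≈ δ k l (δ i j x)
    δ-comm false false k     l     x = refl
    δ-comm true  true  k     l     x = refl
    δ-comm false true  false false x = refl
    δ-comm false true  false true  x = refl
    δ-comm false true  true  false x = refl
    δ-comm false true  true  true  x = refl
    δ-comm true  false false false x = refl
    δ-comm true  false false true  x = refl
    δ-comm true  false true  false x = refl
    δ-comm true  false true  true  x = refl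

    δ-0 : ∀ i j → δ i j 0# ≈ 0#
    δ-0 false false = refl
    δ-0 false true  = refl
    δ-0 true  false = refl
    δ-0 true  true  = refl

    Σᵇ : (Bool → Carrier) → Carrier
    Σᵇ f = f false + f true

    Σᵇ-cong : ∀ {f g} → (∀ i → f i ≈ g i) → Σᵇ f ≈ Σᵇ g
    Σᵇ-cong f≈g = +-cong (f≈g false) (f≈g true)

    Σᵇ-+ : ∀ f g → Σᵇ (λ i → f i + g i) ≈ Σᵇ f + Σᵇ g
    Σᵇ-+ f g = +-interchange (f false) (g false) (f true) (g true)

    Σᵇ-comm : ∀ (f : Bool → Bool → Carrier) → Σᵇ (λ i → Σᵇ (f i)) ≈ Σᵇ (λ j → Σᵇ (λ i → f i j))
    Σᵇ-comm f = Σᵇ-+ (λ i → f i false) (λ i → f i true)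

    Σᵇ-*ˡ : ∀ x f → x * Σᵇ f ≈ Σᵇ (λ i → x * f i)
    Σᵇ-*ˡ x f = distribˡ x (f false) (f true)

    Σᵇ-*ʳ : ∀ f x → Σᵇ f * x ≈ Σᵇ (λ i → f i * x)
    Σᵇ-*ʳ f x = distribʳ x (f false) (f true)

    Σᵇ-• : ∀ k f → k • Σᵇ f ≈ Σᵇ (λ i → k • f i)
    Σᵇ-• k f = •-distribˡ k (f false) (f true)

    Σᵇ-δ : ∀ i (f : Bool → Carrier) → Σᵇ (λ j → δ i j (f j)) ≈ f i
    Σᵇ-δ false f = +-identityʳ (f false)
    Σᵇ-δ true  f = +-identityˡ (f true)

    δ-Σᵇ : ∀ i j f → Σᵇ (λ k → δ i j (f k)) ≈ δ i j (Σᵇ f)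
    δ-Σᵇ i j f = sym (δ-+ i j (f false) (f true))

    Σᵇ-δ-*ˡ : ∀ i (f : Bool → Carrier) b → Σᵇ (λ k → δ i k b * f k) ≈ b * f i
    Σᵇ-δ-*ˡ i f b = trans (Σᵇ-cong λ k → δ-*ʳ i k b (f k)) (Σᵇ-δ i (λ k → b * f k))

    Σᵇ-δ-*ʳ : ∀ j (f : Bool → Carrier) b → Σᵇ (λ k → f k * δ k j b) ≈ f j * b
    Σᵇ-δ-*ʳ j f b = trans
      (Σᵇ-cong λ k → trans (*-congˡ (reflexive (δ-sym k j b))) (δ-*ˡ j k (f k) b))
      (Σᵇ-δ j (λ k → f k * b))

    record Idempotents : Set (a ⊔ ℓa) where
      field
        P          : Bool → Carrier
        orthogonal : ∀ i j → P i * P j ≈ δ i j (P j)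
        complete   : Σᵇ P ≈ 1#

    record MatrixUnits : Set (a ⊔ ℓa) where
      field
        E        : Bool → Bool → Carrier
        compose  : ∀ i j k l → E i j * E k l ≈ δ j k (E i l)
        complete : Σᵇ (λ i → E i i) ≈ 1#

      idempotents : Idempotents
      idempotents = record
        { P = λ i → E i i
        ; orthogonal = λ i j → trans (compose i i j j) (diagonal i j)
        ; complete = complete
        }
        where
        diagonal : ∀ i j → δ i j (E i j) ≈ δ i j (E j j)
        diagonal false false = refl
        diagonal false true  = refl
        diagonal true  false = refl
        diagonal true  true  = refl

  -- Homomorphisms and isomorphisms of algebras

  record Hom (A : Algebra K a ℓa) (B : Algebra K b ℓb) : Set (c ⊔ a ⊔ ℓa ⊔ b ⊔ ℓb) where
    private
      module A = AlgebraReasoning A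
      module B = AlgebraReasoning B
    field
      ⟦_⟧     : A.Carrier → B.Carrier
      cong    : ∀ {x y} → x A.≈ y → ⟦ x ⟧ B.≈ ⟦ y ⟧
      +-homo  : ∀ x y → ⟦ x A.+ y ⟧ B.≈ ⟦ x ⟧ B.+ ⟦ y ⟧
      *-homo  : ∀ x y → ⟦ x A.* y ⟧ B.≈ ⟦ x ⟧ B.* ⟦ y ⟧
      •-homo  : ∀ k x → ⟦ k A.• x ⟧ B.≈ k B.• ⟦ x ⟧
      1#-homo : ⟦ A.1# ⟧ B.≈ B.1#

    0#-homo : ⟦ A.0# ⟧ B.≈ B.0#
    0#-homo = B.trans (cong (A.sym (A.•-zeroʳ K.0#))) (B.trans (•-homo K.0# A.0#) (B.•-zeroˡ _))

    -‿homo : ∀ x → ⟦ A.- x ⟧ B.≈ B.- ⟦ x ⟧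
    -‿homo x = B.+-inverseˡ-unique _ _
      (B.trans (B.sym (+-homo (A.- x) x)) (B.trans (cong (A.-‿inverseˡ x)) 0#-homo))

    sgn-homo : ∀ s x → ⟦ A.sgn s x ⟧ B.≈ B.sgn s ⟦ x ⟧
    sgn-homo false x = B.refl
    sgn-homo true  x = -‿homo x

    δ-homo : ∀ i j x → ⟦ A.δ i j x ⟧ B.≈ B.δ i j ⟦ x ⟧
    δ-homo false false x = B.refl
    δ-homo false true  x = 0#-homo
    δ-homo true  false x = 0#-homo
    δ-homo true  true  x = B.refl

    Σᵇ-homo : ∀ f → ⟦ A.Σᵇ f ⟧ B.≈ B.Σᵇ (λ i → ⟦ f i ⟧)
    Σᵇ-homo f = +-homo (f false) (f true)

    ⋈-homo : ∀ {x s y} → x A.⋈[ s ] y → ⟦ x ⟧ B.⋈[ s ] ⟦ y ⟧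
    ⋈-homo {x} {s} {y} x⋈y = B.mk⋈ (B.trans (B.sym (*-homo x y))
      (B.trans (cong (A.swap x⋈y)) (B.trans (sgn-homo s _) (B.sgn-cong s (*-homo y x)))))

    square-homo : ∀ {x} → x A.* x A.≈ A.- A.1# → ⟦ x ⟧ B.* ⟦ x ⟧ B.≈ B.- B.1#
    square-homo {x} x² = B.trans (B.sym (*-homo x x))
      (B.trans (cong x²) (B.trans (-‿homo A.1#) (B.-‿cong 1#-homo)))

  idᴴ : {A : Algebra K a ℓa} → Hom A A
  idᴴ {A = A} = record
    { ⟦_⟧ = λ x → x ; cong = λ x≈y → x≈y
    ; +-homo = λ _ _ → refl ; *-homo = λ _ _ → refl ; •-homo = λ _ _ → refl ; 1#-homo = refl }
    where open AlgebraReasoning A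

  infixr 9 _∘ᴴ_
  _∘ᴴ_ : {A : Algebra K a ℓa} {B : Algebra K b ℓb} {C : Algebra K d ℓd} →
         Hom B C → Hom A B → Hom A C
  _∘ᴴ_ {C = C} g f = record
    { ⟦_⟧ = λ x → g.⟦ f.⟦ x ⟧ ⟧
    ; cong = λ x≈y → g.cong (f.cong x≈y)
    ; +-homo = λ x y → trans (g.cong (f.+-homo x y)) (g.+-homo _ _)
    ; *-homo = λ x y → trans (g.cong (f.*-homo x y)) (g.*-homo _ _)
    ; •-homo = λ k x → trans (g.cong (f.•-homo k x)) (g.•-homo k _)
    ; 1#-homo = trans (g.cong f.1#-homo) g.1#-homo }
    where
    open AlgebraReasoning C
    module f = Hom f
    module g = Hom g

  record Iso (A : Algebra K a ℓa) (B : Algebra K b ℓb) : Set (c ⊔ a ⊔ ℓa ⊔ b ⊔ ℓb) where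
    private
      module A = AlgebraReasoning A
      module B = AlgebraReasoning B
    field
      to   : Hom A B
      from : Hom B A
    module to   = Hom to
    module from = Hom from
    field
      from-to : ∀ x → from.⟦ to.⟦ x ⟧ ⟧ A.≈ x
      to-from : ∀ y → to.⟦ from.⟦ y ⟧ ⟧ B.≈ y

    to-injective : ∀ {x y} → to.⟦ x ⟧ B.≈ to.⟦ y ⟧ → x A.≈ y
    to-injective {x} {y} fx≈fy = A.trans (A.sym (from-to x)) (A.trans (from.cong fx≈fy) (from-to y))

  Iso-refl : {A : Algebra K a ℓa} → Iso A A
  Iso-refl {A = A} = record { to = idᴴ ; from = idᴴ ; from-to = λ _ → refl ; to-from = λ _ → refl }
    where open AlgebraReasoning A

  Iso-sym : {A : Algebra K a ℓa} {B : Algebra K b ℓb} → Iso A B → Iso B A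
  Iso-sym f = record { to = from ; from = to ; from-to = to-from ; to-from = from-to }
    where open Iso f

  Iso-trans : {A : Algebra K a ℓa} {B : Algebra K b ℓb} {C : Algebra K d ℓd} →
              Iso A B → Iso B C → Iso A C
  Iso-trans {A = A} {C = C} f g = record
    { to = g.to ∘ᴴ f.to
    ; from = f.from ∘ᴴ g.from
    ; from-to = λ x → A.trans (f.from.cong (g.from-to _)) (f.from-to x)
    ; to-from = λ z → C.trans (g.to.cong (f.to-from _)) (g.to-from z) }
    where
    module A = AlgebraReasoning A
    module C = AlgebraReasoning C
    module f = Iso f
    module g = Iso g

-- Anticommuting pairs and 2 × 2 matrix units

record HasHalfAndI (K : CommutativeRing c ℓ) : Set (c ⊔ ℓ) where
  open CommutativeRing K
  field
    ι ½ : Carrier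
    ι²  : ι * ι ≈ - 1#
    ½+½ : ½ + ½ ≈ 1#

module _ {K : CommutativeRing c ℓ} where
  private module K = CommutativeRing K

  module WithScalars (gaussian : HasHalfAndI K) where
    open HasHalfAndI gaussian

    module Clifford (A : Algebra K a ℓa) where
      open AlgebraReasoning A public

      SquaresTo-1 : Carrier → Set ℓa
      SquaresTo-1 x = x * x ≈ - 1#

      Involution : Carrier → Set ℓa
      Involution x = x * x ≈ 1#

      ι•ι• : ∀ x → ι • ι • x ≈ - x
      ι•ι• x = trans (sym (•-assoc ι ι x)) (trans (•-cong ι² refl)
        (trans (neg-• K.1# x) (-‿cong (•-identityˡ x))))

      ι•-square : ∀ x → (ι • x) * (ι • x) ≈ - (x * x)
      ι•-square x = trans (•-*-assoc ι x (ι • x)) (trans (•-congˡ (*-•-comm ι x x)) (ι•ι• (x * x)))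

      ι•-involution : ∀ {x} → SquaresTo-1 x → Involution (ι • x)
      ι•-involution {x} x² = trans (ι•-square x) (trans (-‿cong x²) (-‿involutive 1#))

      halves : ∀ x → ½ • x + ½ • x ≈ x
      halves x = trans (sym (•-distribʳ x ½ ½)) (trans (•-cong ½+½ refl) (•-identityˡ x))

      ½•[x+x] : ∀ x → ½ • (x + x) ≈ x
      ½•[x+x] x = trans (•-distribˡ ½ x x) (halves x)

      ½•-* : ∀ x y → (½ • x) * (½ • y) ≈ ½ • ½ • (x * y)
      ½•-* x y = trans (•-*-assoc ½ x (½ • y)) (•-congˡ (*-•-comm ½ x y))

      [1+w]² : ∀ {w} → Involution w → (1# + w) * (1# + w) ≈ (1# + w) + (1# + w)
      [1+w]² {w} w² = trans (distribˡ (1# + w) 1# w) (+-cong (*-identityʳ _)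
        (trans (distribʳ w 1# w) (trans (+-cong (*-identityˡ w) w²) (+-comm w 1#))))

      [1+w][1-w] : ∀ {w} → Involution w → (1# + w) * (1# + - w) ≈ 0#
      [1+w][1-w] {w} w² = trans (distribˡ (1# + w) 1# (- w)) (trans (+-cong (*-identityʳ _)
        (trans (sym (-‿distribʳ-* (1# + w) w)) (-‿cong
          (trans (distribʳ w 1# w) (trans (+-cong (*-identityˡ w) w²) (+-comm w 1#))))))
        (-‿inverseʳ (1# + w)))

      sgn-involution : ∀ s {z} → Involution z → Involution (sgn s z)
      sgn-involution false z² = z²
      sgn-involution true  z² = trans (neg-*-neg _ _) z²

      -- The spectral projections of the involution `ι • p`: `true` belongs to the eigenvalue 1 and
      -- `false` to -1. In terms of `p` the eigenvalues are `- ι` and `ι`.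
      projection : Carrier → Bool → Carrier
      projection p i = ½ • (1# + sgn (not i) (ι • p))

      projection-idem : ∀ {p} → SquaresTo-1 p → ∀ i → projection p i * projection p i ≈ projection p i
      projection-idem p² i = trans (½•-* _ _) (trans (•-congˡ (•-congˡ
        ([1+w]² (sgn-involution (not i) (ι•-involution p²))))) (•-congˡ (½•[x+x] _)))

      projection-orth : ∀ {p} → SquaresTo-1 p → ∀ i → projection p i * projection p (not i) ≈ 0#
      projection-orth {p} p² i = trans (½•-* _ _) (trans (•-congˡ (trans (•-congˡ (trans
        (*-congˡ (+-congˡ (opposite i)))
        ([1+w][1-w] (sgn-involution (not i) (ι•-involution p²))))) (•-zeroʳ ½))) (•-zeroʳ ½))
        where
        opposite : ∀ i → sgn (not (not i)) (ι • p) ≈ - sgn (not i) (ι • p)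
        opposite false = sym (-‿involutive (ι • p))
        opposite true  = refl

      projections : ∀ {p} → SquaresTo-1 p → Idempotents
      projections {p} p² = record
        { P = projection p
        ; orthogonal = λ
          { false false → projection-idem p² false
          ; false true  → projection-orth p² false
          ; true  false → projection-orth p² true
          ; true  true  → projection-idem p² true
          }
        ; complete = begin
            ½ • (1# + - z) + ½ • (1# + z) ≈⟨ •-distribˡ ½ (1# + - z) (1# + z) ⟨
            ½ • ((1# + - z) + (1# + z))   ≈⟨ •-congˡ (+-interchange 1# (- z) 1# z) ⟩
            ½ • ((1# + 1#) + (- z + z))   ≈⟨ •-congˡ (trans (+-congˡ (-‿inverseˡ z)) (+-identityʳ _)) ⟩
            ½ • (1# + 1#)                 ≈⟨ ½•[x+x] 1# ⟩
            1#                            ∎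
        }
        where z = ι • p

      -- The element with eigenvalue `ι` on `P false` and `- ι` on `P true`. It undoes `projection`,
      -- so square roots of -1 and complete pairs of orthogonal idempotents carry the same
      -- information.
      splitting : (Bool → Carrier) → Carrier
      splitting P = ι • (P false + - P true)

      splitting-square : (I : Idempotents) → let open Idempotents I in SquaresTo-1 (splitting P)
      splitting-square I = trans (ι•-square _) (-‿cong (begin
        (P false + - P true) * (P false + - P true)
          ≈⟨ distribʳ _ (P false) (- P true) ⟩
        P false * (P false + - P true) + - P true * (P false + - P true)
          ≈⟨ +-cong (eigen false) (trans (sym (-‿distribˡ-* (P true) _))
               (trans (-‿cong (eigen true)) (-‿involutive (P true)))) ⟩
        P false + P true
          ≈⟨ complete ⟩
        1# ∎))
        where
        open Idempotents I
        eigen : ∀ i → P i * (P false + - P true) ≈ sgn i (P i)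
        eigen false = trans (distribˡ _ _ _) (trans (+-cong (orthogonal false false)
          (trans (sym (-‿distribʳ-* _ _)) (trans (-‿cong (orthogonal false true)) -0#≈0#))) (+-identityʳ _))
        eigen true = trans (distribˡ _ _ _) (trans (+-cong (orthogonal true false)
          (trans (sym (-‿distribʳ-* _ _)) (-‿cong (orthogonal true true)))) (+-identityˡ _))

      splitting-projection : ∀ p → splitting (projection p) ≈ p
      splitting-projection p = begin
        ι • (½ • (1# + - z) + - (½ • (1# + z))) ≈⟨ •-congˡ (+-congˡ (•-neg ½ (1# + z))) ⟨
        ι • (½ • (1# + - z) + ½ • (- (1# + z))) ≈⟨ •-congˡ (•-distribˡ ½ _ _) ⟨
        ι • ½ • ((1# + - z) + - (1# + z))       ≈⟨ •-congˡ (•-congˡ (+-congˡ (-‿+-comm 1# z))) ⟨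
        ι • ½ • ((1# + - z) + (- 1# + - z))     ≈⟨ •-congˡ (•-congˡ (+-interchange 1# (- z) (- 1#) (- z))) ⟩
        ι • ½ • ((1# + - 1#) + (- z + - z))     ≈⟨ •-congˡ (•-congˡ (trans (+-congʳ (-‿inverseʳ 1#)) (+-identityˡ _))) ⟩
        ι • ½ • (- z + - z)                     ≈⟨ •-congˡ (½•[x+x] (- z)) ⟩
        ι • (- z)                               ≈⟨ •-neg ι z ⟩
        - (ι • ι • p)                           ≈⟨ -‿cong (ι•ι• p) ⟩
        - - p                                   ≈⟨ -‿involutive p ⟩
        p                                       ∎
        where z = ι • p

      -- With `1#` written as `P false + P true`, adding or subtracting the difference of the
      -- idempotents cancels one of them and doubles the other; `½` removes the factor 2.
      projection-splitting : (I : Idempotents) → let open Idempotents I in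
                             ∀ i → projection (splitting P) i ≈ P i
      projection-splitting I i = trans (•-congˡ (trans (+-cong (sym complete)
        (trans (sgn-cong (not i) (ι•ι• _)) (signs i))) (double i))) (½•[x+x] (P i))
        where
        open Idempotents I
        Q = P false + - P true
        signs : ∀ i → sgn (not i) (- Q) ≈ sgn i Q
        signs false = -‿involutive Q
        signs true  = refl
        double : ∀ i → (P false + P true) + sgn i Q ≈ P i + P i
        double false = trans (+-interchange _ _ _ _) (trans (+-congˡ (-‿inverseʳ (P true))) (+-identityʳ _))
        double true  = trans (+-congˡ (sym (-‿+-comm (P false) (- P true))))
          (trans (+-interchange _ _ _ _) (trans (+-cong (-‿inverseʳ (P false)) (+-congˡ (-‿involutive (P true))))
          (+-identityˡ _)))

      projection-⋈ : ∀ {x p} → x ⋈[ false ] p → ∀ i → x ⋈[ false ] projection p i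
      projection-⋈ {x} x⋈p i = ⋈-• ½ (⋈-+ (⋈-1 x) (⋈-sgn (not i) (⋈-• ι x⋈p)))

      splitting-⋈ : ∀ {x P} → (∀ i → x ⋈[ false ] P i) → x ⋈[ false ] splitting P
      splitting-⋈ x⋈P = ⋈-• ι (⋈-+ (x⋈P false) (⋈-sgn true (x⋈P true)))

      record AnticommutingPair : Set (a ⊔ ℓa) where
        field
          p q : Carrier
          p²  : SquaresTo-1 p
          q²  : SquaresTo-1 q
          p⋈q : p ⋈[ true ] q

        -- Since `q` anticommutes with `p`, moving it across reverses the sign of `ι • p`, and so
        -- exchanges the two eigenspaces of `p`.
        q-projection : ∀ i → q * projection p (not i) ≈ projection p i * q
        q-projection i = begin
          q * (½ • (1# + sgn (not (not i)) (ι • p)))  ≈⟨ *-•-comm ½ q _ ⟩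
          ½ • (q * (1# + sgn (not (not i)) (ι • p)))
            ≈⟨ •-congˡ (trans (distribˡ q 1# _) (+-cong (swap (⋈-1 q)) (slide i))) ⟩
          ½ • (1# * q + sgn (not i) (ι • p) * q)      ≈⟨ •-congˡ (distribʳ q 1# _) ⟨
          ½ • ((1# + sgn (not i) (ι • p)) * q)        ≈⟨ •-*-assoc ½ _ q ⟨
          (½ • (1# + sgn (not i) (ι • p))) * q        ∎
          where
          slide : ∀ i → q * sgn (not (not i)) (ι • p) ≈ sgn (not i) (ι • p) * q
          slide false = trans (swap (⋈-• ι (⋈-sym p⋈q))) (-‿distribˡ-* (ι • p) q)
          slide true  = trans (swap (⋈-sgn true (⋈-• ι (⋈-sym p⋈q))))
            (trans (-‿distribˡ-* _ _) (*-congʳ (-‿involutive (ι • p))))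

        -- Transition elements between the two eigenspaces of `p`. The inverse of `q` is `- q`,
        -- which forces the sign in one direction and makes `w i j * w j k` equal to `w i k`.
        w : Bool → Bool → Carrier
        w false false = 1#
        w false true  = q
        w true  false = - q
        w true  true  = 1#

        w-* : ∀ i j k → w i j * w j k ≈ w i k
        w-* false false k     = *-identityˡ (w false k)
        w-* true  true  k     = *-identityˡ (w true k)
        w-* false true  true  = *-identityʳ q
        w-* true  false false = *-identityʳ (- q)
        w-* false true  false = trans (sym (-‿distribʳ-* q q)) (trans (-‿cong q²) (-‿involutive 1#))
        w-* true  false true  = trans (sym (-‿distribˡ-* q q)) (trans (-‿cong q²) (-‿involutive 1#))

        w-projection : ∀ i j → w i j * projection p j ≈ projection p i * w i j
        w-projection false false = sym (swap (⋈-1 _))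
        w-projection true  true  = sym (swap (⋈-1 _))
        w-projection false true  = q-projection false
        w-projection true  false = trans (sym (-‿distribˡ-* q _))
          (trans (-‿cong (q-projection true)) (-‿distribʳ-* _ q))

        matrixUnit : Bool → Bool → Carrier
        matrixUnit i j = projection p i * w i j

        matrixUnits : MatrixUnits
        matrixUnits = record
          { E        = matrixUnit
          ; compose  = λ i j k l → begin
              (projection p i * w i j) * (projection p k * w k l)
                ≈⟨ *-congʳ (w-projection i j) ⟨
              (w i j * projection p j) * (projection p k * w k l)
                ≈⟨ *-assoc _ _ _ ⟩
              w i j * (projection p j * (projection p k * w k l))
                ≈⟨ *-congˡ (*-assoc _ _ _) ⟨
              w i j * (projection p j * projection p k * w k l)
                ≈⟨ *-congˡ (trans (*-congʳ (orthogonal j k)) (δ-*ʳ j k _ _)) ⟩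
              w i j * δ j k (projection p k * w k l)
                ≈⟨ δ-*ˡ j k _ _ ⟩
              δ j k (w i j * (projection p k * w k l))
                ≈⟨ collapse i j k l ⟩
              δ j k (projection p i * w i l) ∎
          ; complete = trans (+-cong (*-identityʳ _) (*-identityʳ _)) complete
          }
          where
          open Idempotents (projections p²)
          collapse′ : ∀ i j l → w i j * (projection p j * w j l) ≈ projection p i * w i l
          collapse′ i j l = trans (sym (*-assoc _ _ _)) (trans (*-congʳ (w-projection i j))
            (trans (*-assoc _ _ _) (*-congˡ (w-* i j l))))
          collapse : ∀ i j k l → δ j k (w i j * (projection p k * w k l)) ≈ δ j k (projection p i * w i l)
          collapse i false false l = collapse′ i false l
          collapse i false true  l = refl
          collapse i true  false l = refl
          collapse i true  true  l = collapse′ i true l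

        p-matrixUnits : splitting (λ i → matrixUnit i i) ≈ p
        p-matrixUnits = trans (•-congˡ (+-cong (*-identityʳ _) (-‿cong (*-identityʳ _)))) (splitting-projection p)

        -- The off-diagonal units are `projection p false * q` and `- (projection p true * q)`, so
        -- their difference is `q` by completeness. Together with `p-matrixUnits` this recovers the
        -- pair from its matrix units.
        q-matrixUnits : matrixUnit false true + - matrixUnit true false ≈ q
        q-matrixUnits = begin
          projection p false * q + - (projection p true * - q)  ≈⟨ +-congˡ (-‿distribʳ-* _ _) ⟩
          projection p false * q + projection p true * - - q    ≈⟨ +-congˡ (*-congˡ (-‿involutive q)) ⟩
          projection p false * q + projection p true * q        ≈⟨ distribʳ q _ _ ⟨
          (projection p false + projection p true) * q          ≈⟨ *-congʳ (Idempotents.complete (projections p²)) ⟩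
          1# * q                                                ≈⟨ *-identityˡ q ⟩
          q                                                     ∎

        matrixUnit-⋈ : ∀ {x} → x ⋈[ false ] p → x ⋈[ false ] q → ∀ i j → x ⋈[ false ] matrixUnit i j
        matrixUnit-⋈ {x} x⋈p x⋈q i j = ⋈-* (projection-⋈ x⋈p i) (w-⋈ i j)
          where
          w-⋈ : ∀ i j → x ⋈[ false ] w i j
          w-⋈ false false = ⋈-1 x
          w-⋈ false true  = x⋈q
          w-⋈ true  false = ⋈-sgn true x⋈q
          w-⋈ true  true  = ⋈-1 x

        -- The Pauli matrices, indexed by their signs against `p` and against `q`; this is why
        -- `ι • p`, which commutes with `p` and anticommutes with `q`, has the index `false true`.
        -- The factor `ι` makes each of them an involution, so that multiplying twice by the same
        -- one changes nothing.
        pauli : Bool → Bool → Carrier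
        pauli false false = 1#
        pauli false true  = ι • p
        pauli true  false = ι • q
        pauli true  true  = ι • (p * q)

        pauli-involution : ∀ s t → Involution (pauli s t)
        pauli-involution false false = *-identityˡ 1#
        pauli-involution false true  = ι•-involution p²
        pauli-involution true  false = ι•-involution q²
        pauli-involution true  true  = ι•-involution (trans (square-* (⋈-sym p⋈q))
          (-‿cong (trans (*-cong p² q²) (trans (neg-*-neg 1# 1#) (*-identityˡ 1#)))))

        -- The factor `p` occurs in `pauli i j` exactly when `j` is `true`, and `q` exactly when `i`
        -- is. The sign is therefore the symplectic pairing of `(s , t)` with `(i , j)`.
        pauli-⋈ : ∀ {x s t} → x ⋈[ s ] p → x ⋈[ t ] q → ∀ i j → x ⋈[ (j ∧ s) xor (i ∧ t) ] pauli i j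
        pauli-⋈ {x} x⋈p x⋈q false false = ⋈-1 x
        pauli-⋈ {s = false} x⋈p x⋈q false true = ⋈-• ι x⋈p
        pauli-⋈ {s = true}  x⋈p x⋈q false true = ⋈-• ι x⋈p
        pauli-⋈ x⋈p x⋈q true  false = ⋈-• ι x⋈q
        pauli-⋈ x⋈p x⋈q true  true  = ⋈-• ι (⋈-* x⋈p x⋈q)

        pauli-p : ∀ s t → pauli s t ⋈[ s ] p
        pauli-p false false = ⋈-sym (pauli-⋈ (⋈-refl p) p⋈q false false)
        pauli-p false true  = ⋈-sym (pauli-⋈ (⋈-refl p) p⋈q false true)
        pauli-p true  false = ⋈-sym (pauli-⋈ (⋈-refl p) p⋈q true false)
        pauli-p true  true  = ⋈-sym (pauli-⋈ (⋈-refl p) p⋈q true true)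

        pauli-q : ∀ s t → pauli s t ⋈[ t ] q
        pauli-q false false = ⋈-sym (pauli-⋈ (⋈-sym p⋈q) (⋈-refl q) false false)
        pauli-q false true  = ⋈-sym (pauli-⋈ (⋈-sym p⋈q) (⋈-refl q) false true)
        pauli-q true  false = ⋈-sym (pauli-⋈ (⋈-sym p⋈q) (⋈-refl q) true false)
        pauli-q true  true  = ⋈-sym (pauli-⋈ (⋈-sym p⋈q) (⋈-refl q) true true)

        twist-twice : ∀ x s t → x * pauli s t * pauli s t ≈ x
        twist-twice x s t = trans (*-assoc x _ _) (trans (*-congˡ (pauli-involution s t)) (*-identityʳ x))

        -- Used in two directions: `s = a` frees a generator of the graph algebra from `p`, and
        -- `a = false` gives a scalar matrix the prescribed sign `s`.
        twist-p : ∀ {x a} → x ⋈[ a ] p → ∀ s t → x * pauli s t ⋈[ a xor s ] p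
        twist-p x⋈p s t = ⋈-sym (⋈-* (⋈-sym x⋈p) (⋈-sym (pauli-p s t)))

        twist-q : ∀ {x b} → x ⋈[ b ] q → ∀ s t → x * pauli s t ⋈[ b xor t ] q
        twist-q x⋈q s t = ⋈-sym (⋈-* (⋈-sym x⋈q) (⋈-sym (pauli-q s t)))

        -- Four signs multiply: `x` against `y`, the first Pauli factor against `y`, `x` against the
        -- second Pauli factor, and the two Pauli factors against each other.
        twist-twist : ∀ {x y r a b a′ b′} → x ⋈[ r ] y → x ⋈[ a ] p → x ⋈[ b ] q →
          y ⋈[ a′ ] p → y ⋈[ b′ ] q → ∀ s t s′ t′ → x * pauli s t ⋈[ (r xor ((t ∧ a′) xor (s ∧ b′))) xor
                                         (((t′ ∧ a) xor (s′ ∧ b)) xor ((t′ ∧ s) xor (s′ ∧ t))) ] y * pauli s′ t′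
        twist-twist x⋈y x⋈p x⋈q y⋈p y⋈q s t s′ t′ = ⋈-*
          (⋈-sym (⋈-* (⋈-sym x⋈y) (pauli-⋈ y⋈p y⋈q s t)))
          (⋈-sym (⋈-* (⋈-sym (pauli-⋈ x⋈p x⋈q s′ t′)) (⋈-sym (pauli-⋈ (pauli-p s t) (pauli-q s t) s′ t′))))

        twist-square : ∀ {x a b} → SquaresTo-1 x → x ⋈[ a ] p → x ⋈[ b ] q →
          ∀ s t → (t ∧ a) xor (s ∧ b) ≡ false → SquaresTo-1 (x * pauli s t)
        twist-square {x} x² x⋈p x⋈q s t commuting = trans
          (square-* (⋈-sym (≡.subst (λ r → x ⋈[ r ] pauli s t) commuting (pauli-⋈ x⋈p x⋈q s t))))
          (trans (*-cong x² (pauli-involution s t)) (*-identityʳ (- 1#)))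

      module PairOfUnits (M : MatrixUnits) where
        open MatrixUnits M

        private
          -- As matrices, diag(ι, -ι) and the rotation with rows (0, 1) and (-1, 0). These are the
          -- left sides of `p-matrixUnits` and `q-matrixUnits` with the given units, so the passages
          -- between pairs and matrix units are mutually inverse.
          p′ q′ : Carrier
          p′ = splitting (λ i → E i i)
          q′ = E false true + - E true false

        E-q : ∀ i j → E i j * q′ ≈ sgn j (E i (not j))
        E-q i false = trans (distribˡ _ _ _) (trans (+-cong (compose _ _ _ _)
          (trans (sym (-‿distribʳ-* _ _)) (trans (-‿cong (compose _ _ _ _)) -0#≈0#))) (+-identityʳ _))
        E-q i true  = trans (distribˡ _ _ _) (trans (+-cong (compose _ _ _ _)
          (trans (sym (-‿distribʳ-* _ _)) (-‿cong (compose _ _ _ _)))) (+-identityˡ _))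

        q-E : ∀ i j → q′ * E i j ≈ sgn (not i) (E (not i) j)
        q-E false j = trans (distribʳ _ _ _) (trans (+-cong (compose _ _ _ _)
          (trans (sym (-‿distribˡ-* _ _)) (-‿cong (compose _ _ _ _)))) (+-identityˡ _))
        q-E true  j = trans (distribʳ _ _ _) (trans (+-cong (compose _ _ _ _)
          (trans (sym (-‿distribˡ-* _ _)) (trans (-‿cong (compose _ _ _ _)) -0#≈0#))) (+-identityʳ _))

        pair : AnticommutingPair
        pair = record
          { p   = p′
          ; q   = q′
          ; p²  = splitting-square idempotents
          ; q²  = begin
              (E false true + - E true false) * q′       ≈⟨ [y-z]x≈yx-zx q′ _ _ ⟩
              E false true * q′ + - (E true false * q′)  ≈⟨ +-cong (E-q false true) (-‿cong (E-q true false)) ⟩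
              - E false false + - E true true            ≈⟨ -‿+-comm _ _ ⟩
              - (E false false + E true true)            ≈⟨ -‿cong complete ⟩
              - 1#                                       ∎
          ; p⋈q = mk⋈ (begin
              p′ * q′                                      ≈⟨ •-*-assoc ι _ q′ ⟩
              ι • ((E false false + - E true true) * q′)   ≈⟨ •-congˡ anticommute ⟩
              ι • - (q′ * (E false false + - E true true)) ≈⟨ •-neg ι _ ⟩
              - (ι • (q′ * (E false false + - E true true))) ≈⟨ -‿cong (*-•-comm ι q′ _) ⟨
              - (q′ * p′)                                  ∎)
          }
          where
          anticommute : (E false false + - E true true) * q′ ≈ - (q′ * (E false false + - E true true))
          anticommute = begin
            (E false false + - E true true) * q′        ≈⟨ [y-z]x≈yx-zx q′ _ _ ⟩
            E false false * q′ + - (E true true * q′)   ≈⟨ +-cong (E-q false false) (-‿cong (E-q true true)) ⟩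
            E false true + - - E true false             ≈⟨ +-congʳ (-‿involutive _) ⟨
            - - E false true + - - E true false         ≈⟨ +-comm _ _ ⟩
            - - E true false + - - E false true         ≈⟨ -‿+-comm _ _ ⟩
            - (- E true false + - E false true)         ≈⟨ -‿cong (+-cong (q-E false false) (-‿cong (q-E true true))) ⟨
            - (q′ * E false false + - (q′ * E true true)) ≈⟨ -‿cong (x[y-z]≈xy-xz q′ _ _) ⟨
            - (q′ * (E false false + - E true true))    ∎

        open AnticommutingPair pair

        pair-⋈ : ∀ {x} → (∀ i j → x ⋈[ false ] E i j) → x ⋈[ false ] p × x ⋈[ false ] q
        pair-⋈ x⋈E = splitting-⋈ (λ i → x⋈E i i) , ⋈-+ (x⋈E false true) (⋈-sgn true (x⋈E true false))

        -- The diagonal is `projection-splitting`. Off the diagonal, multiplying `E i i` by the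
        -- transition element moves the column index, and the sign in `w true false` cancels that of
        -- `E-q`.
        matrixUnit-pair : ∀ i j → matrixUnit i j ≈ E i j
        matrixUnit-pair i j = trans (*-congʳ (projection-splitting idempotents i)) (row i j)
          where
          row : ∀ i j → E i i * w i j ≈ E i j
          row false false = *-identityʳ _
          row false true  = E-q false false
          row true  false = trans (sym (-‿distribʳ-* _ _)) (trans (-‿cong (E-q true true)) (-‿involutive _))
          row true  true  = *-identityʳ _

    module CliffordHom {A : Algebra K a ℓa} {B : Algebra K b ℓb} (f : Hom A B) where
      private
        module A = Clifford A
        module B = Clifford B
      open Hom f

      splitting-homo : ∀ P {Q} → (∀ i → ⟦ P i ⟧ B.≈ Q i) → ⟦ A.splitting P ⟧ B.≈ B.splitting Q
      splitting-homo P fP≈Q = B.trans (•-homo ι _) (B.•-congˡ (B.trans (+-homo _ _)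
        (B.+-cong (fP≈Q false) (B.trans (-‿homo (P true)) (B.-‿cong (fP≈Q true))))))

      projection-homo : ∀ {p p′} → ⟦ p ⟧ B.≈ p′ → ∀ i → ⟦ A.projection p i ⟧ B.≈ B.projection p′ i
      projection-homo {p} fp≈p′ i = B.trans (•-homo ½ _) (B.•-congˡ (B.trans (+-homo _ _)
        (B.+-cong 1#-homo (B.trans (sgn-homo (not i) (ι A.• p)) (B.sgn-cong (not i)
          (B.trans (•-homo ι p) (B.•-congˡ fp≈p′)))))))

      module _ (S : A.AnticommutingPair) (T : B.AnticommutingPair)
        (p≈ : ⟦ A.AnticommutingPair.p S ⟧ B.≈ B.AnticommutingPair.p T)
        (q≈ : ⟦ A.AnticommutingPair.q S ⟧ B.≈ B.AnticommutingPair.q T) where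
        private
          module S = A.AnticommutingPair S
          module T = B.AnticommutingPair T

        pauli-homo : ∀ s t → ⟦ S.pauli s t ⟧ B.≈ T.pauli s t
        pauli-homo false false = 1#-homo
        pauli-homo false true  = B.trans (•-homo ι S.p) (B.•-congˡ p≈)
        pauli-homo true  false = B.trans (•-homo ι S.q) (B.•-congˡ q≈)
        pauli-homo true  true  = B.trans (•-homo ι _) (B.•-congˡ (B.trans (*-homo S.p S.q) (B.*-cong p≈ q≈)))

        matrixUnit-homo : ∀ i j → ⟦ S.matrixUnit i j ⟧ B.≈ T.matrixUnit i j
        matrixUnit-homo i j = B.trans (*-homo _ _) (B.*-cong (projection-homo p≈ i) (w-homo i j))
          where
          w-homo : ∀ i j → ⟦ S.w i j ⟧ B.≈ T.w i j
          w-homo false false = 1#-homo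
          w-homo false true  = q≈
          w-homo true  false = B.trans (-‿homo S.q) (B.-‿cong q≈)
          w-homo true  true  = 1#-homo

module _ {K : CommutativeRing c ℓ} where
  private module K = CommutativeRing K

  -- The algebras B × B and M₂(B), and their centres

  pointwise-isLeftModule : ∀ {i} (I : Set i) {M : Set a} {_≈_ : M → M → Set ℓa} {_+_ 0# -_ _•_} →
    IsLeftModule K.ring _≈_ _+_ 0# -_ _•_ →
    IsLeftModule K.ring (λ (x y : I → M) → ∀ i → x i ≈ y i)
      (λ x y i → x i + y i) (λ _ → 0#) (λ x i → - x i) (λ k x i → k • x i)
  pointwise-isLeftModule I isLeftModule = record
    { isLeftSemimodule = record
      { +ᴹ-isCommutativeMonoid = Pointwise.isCommutativeMonoid I +ᴹ-isCommutativeMonoid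
      ; isPreleftSemimodule = record
        { *ₗ-cong      = λ k≈l x≈y i → *ₗ-cong k≈l (x≈y i)
        ; *ₗ-zeroˡ     = λ x i → *ₗ-zeroˡ (x i)
        ; *ₗ-distribʳ  = λ x k l i → *ₗ-distribʳ (x i) k l
        ; *ₗ-identityˡ = λ x i → *ₗ-identityˡ (x i)
        ; *ₗ-assoc     = λ k l x i → *ₗ-assoc k l (x i)
        ; *ₗ-zeroʳ     = λ k i → *ₗ-zeroʳ k
        ; *ₗ-distribˡ  = λ k x y i → *ₗ-distribˡ k (x i) (y i)
        }
      }
    ; -ᴹ‿cong    = λ x≈y i → -ᴹ‿cong (x≈y i)
    ; -ᴹ‿inverse = (λ x i → -ᴹ‿inverseˡ (x i)) , (λ x i → -ᴹ‿inverseʳ (x i))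
    }
    where open IsLeftModule isLeftModule

  -- The product B × B as functions on `Bool`, so that coordinates and idempotents share their index
  -- type.
  Square : Algebra K a ℓa → Algebra K a ℓa
  Square B = record
    { isRing       = Pointwise.isRing Bool isRing
    ; isLeftModule = pointwise-isLeftModule Bool isLeftModule
    ; •-*-assoc    = λ k x y i → •-*-assoc k (x i) (y i)
    ; *-•-comm     = λ k x y i → *-•-comm k (x i) (y i)
    }
    where open Algebra B

  module _ (B : Algebra K a ℓa) where
    open AlgebraReasoning B

    private
      _*ᴹ_ : (x y : Bool → Bool → Carrier) → Bool → Bool → Carrier
      (x *ᴹ y) i j = Σᵇ λ k → x i k * y k j

    Matrix : Algebra K a ℓa
    Matrix = record
      { Carrier = Bool → Bool → Carrier
      ; _*_ = _*ᴹ_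
      ; 1# = λ i j → δ i j 1#
      ; isRing = record
        { +-isAbelianGroup = 
            Pointwise.isAbelianGroup Bool (Pointwise.isAbelianGroup Bool (Ring.+-isAbelianGroup ring))
        ; *-cong = λ x≈x′ y≈y′ i j → Σᵇ-cong λ k → *-cong (x≈x′ i k) (y≈y′ k j)
        ; *-assoc = λ x y z i j → begin
            Σᵇ (λ k → Σᵇ (λ l → x i l * y l k) * z k j)
              ≈⟨ Σᵇ-cong (λ k → trans (Σᵇ-*ʳ (λ l → x i l * y l k) (z k j))
                   (Σᵇ-cong λ l → *-assoc (x i l) (y l k) (z k j))) ⟩
            Σᵇ (λ k → Σᵇ (λ l → x i l * (y l k * z k j)))
              ≈⟨ Σᵇ-comm (λ k l → x i l * (y l k * z k j)) ⟩
            Σᵇ (λ l → Σᵇ (λ k → x i l * (y l k * z k j)))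
              ≈⟨ Σᵇ-cong (λ l → Σᵇ-*ˡ (x i l) (λ k → y l k * z k j)) ⟨
            Σᵇ (λ l → x i l * Σᵇ (λ k → y l k * z k j)) ∎
        ; *-identity =
            (λ x i j → trans (Σᵇ-δ-*ˡ i (λ k → x k j) 1#) (*-identityˡ (x i j))) ,
            (λ x i j → trans (Σᵇ-δ-*ʳ j (x i) 1#) (*-identityʳ (x i j)))
        ; distrib =
            (λ x y z i j → trans (Σᵇ-cong λ k → distribˡ (x i k) (y k j) (z k j))
              (Σᵇ-+ (λ k → x i k * y k j) (λ k → x i k * z k j))) ,
            (λ x y z i j → trans (Σᵇ-cong λ k → distribʳ (x k j) (y i k) (z i k))
              (Σᵇ-+ (λ k → y i k * x k j) (λ k → z i k * x k j)))
        }
      ; isLeftModule = pointwise-isLeftModule Bool (pointwise-isLeftModule Bool isLeftModule)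
      ; •-*-assoc = λ r x y i j → trans
          (Σᵇ-cong λ k → •-*-assoc r (x i k) (y k j))
          (sym (Σᵇ-• r (λ k → x i k * y k j)))
      ; *-•-comm  = λ r x y i j → trans
          (Σᵇ-cong λ k → *-•-comm r (x i k) (y k j))
          (sym (Σᵇ-• r (λ k → x i k * y k j)))
      }

  module SquareProperties (B : Algebra K a ℓa) where
    open AlgebraReasoning B
    private
      module □ = AlgebraReasoning (Square B)

    constant : Hom B (Square B)
    constant = record
      { ⟦_⟧ = const ; cong = λ x≈y _ → x≈y
      ; +-homo = λ _ _ _ → refl ; *-homo = λ _ _ _ → refl ; •-homo = λ _ _ _ → refl
      ; 1#-homo = λ _ → refl }

    indicators : □.Idempotents
    indicators = record
      { P = λ i k → δ i k 1#
      ; orthogonal = λ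
        { false false false → *-identityˡ 1#
        ; false false true  → zeroˡ 0#
        ; false true  false → zeroʳ 1#
        ; false true  true  → zeroˡ 1#
        ; true  false false → zeroˡ 1#
        ; true  false true  → zeroʳ 1#
        ; true  true  false → zeroˡ 0#
        ; true  true  true  → *-identityˡ 1# }
      ; complete = λ { false → +-identityʳ 1# ; true → +-identityˡ 1# }
      }

    constant-⋈-indicators : ∀ b i → const b □.⋈[ false ] □.Idempotents.P indicators i
    constant-⋈-indicators b i = □.mk⋈ λ k → trans (δ-*ˡ i k b 1#)
      (trans (δ-cong i k (swap (⋈-1 b))) (sym (δ-*ʳ i k 1# b)))

    -- The coefficients are constant functions, that is, elements of the copy of `B`. In this form a
    -- composite landing in `Square B` can be identified from its effect on constants and
    -- idempotents.
    Square-decompose : ∀ (x : □.Carrier) → □.Σᵇ (λ i → const (x i) □.* □.Idempotents.P indicators i) □.≈ x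
    Square-decompose x k = trans (Σᵇ-cong λ i → *-congˡ {x i} (reflexive (δ-sym i k 1#)))
      (trans (Σᵇ-cong λ i → trans (δ-*ˡ k i (x i) 1#) (δ-cong k i (*-identityʳ (x i)))) (Σᵇ-δ k x))

    -- Multiplication is coordinatewise, and constant functions reach every element of `B` in either
    -- coordinate; so an element is central exactly when both coordinates are.
    Square-centre : LinearBijection (DirectProduct.leftModule (centre B) (centre B)) (centre (Square B))
    Square-centre = record
      { ⟦_⟧ = λ ((x , x-central) , (y , y-central)) → choose x y ,
          λ { z false → x-central (z false) ; z true → y-central (z true) }
      ; cong = λ { (x≈ , y≈) false → x≈ ; (x≈ , y≈) true → y≈ }
      ; +-homo = λ { _ _ false → refl ; _ _ true → refl }
      ; •-homo = λ { _ _ false → refl ; _ _ true → refl }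
      ; injective = λ x≈y → x≈y false , x≈y true
      ; surjective = λ (z , z-central) →
          ((z false , λ b → z-central (const b) false) , (z true , λ b → z-central (const b) true)) ,
          λ { false → refl ; true → refl }
      }
      where
      choose : Carrier → Carrier → Bool → Carrier
      choose x y false = x
      choose x y true  = y

  module MatrixProperties (B : Algebra K a ℓa) where
    open AlgebraReasoning B
    private
      module M = AlgebraReasoning (Matrix B)

    scalar : Hom B (Matrix B)
    scalar = record
      { ⟦_⟧     = λ b i j → δ i j b
      ; cong    = λ x≈y i j → δ-cong i j x≈y
      ; +-homo  = λ x y i j → δ-+ i j x y
      ; *-homo  = λ x y i j → sym (trans (Σᵇ-δ-*ˡ i (λ k → δ k j y) x) (δ-*ˡ i j x y))
      ; •-homo  = λ k x i j → δ-• i j k x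
      ; 1#-homo = λ i j → refl }

    module scalar = Hom scalar

    scalar-*ˡ : ∀ b (x : M.Carrier) i j → (scalar.⟦ b ⟧ M.* x) i j ≈ b * x i j
    scalar-*ˡ b x i j = Σᵇ-δ-*ˡ i (λ k → x k j) b

    scalar-*ʳ : ∀ b (x : M.Carrier) i j → (x M.* scalar.⟦ b ⟧) i j ≈ x i j * b
    scalar-*ʳ b x i j = Σᵇ-δ-*ʳ j (x i) b

    unitMatrix : Bool → Bool → M.Carrier
    unitMatrix i j k l = δ i k (δ j l 1#)

    unitMatrix-*ˡ : ∀ i j (x : M.Carrier) k l → (unitMatrix i j M.* x) k l ≈ δ i k (x j l)
    unitMatrix-*ˡ i j x k l = begin
      Σᵇ (λ m → δ i k (δ j m 1#) * x m l)
        ≈⟨ Σᵇ-cong (λ m → *-congʳ {x m l} (δ-comm i k j m 1#)) ⟩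
      Σᵇ (λ m → δ j m (δ i k 1#) * x m l)
        ≈⟨ Σᵇ-δ-*ˡ j (λ m → x m l) (δ i k 1#) ⟩
      δ i k 1# * x j l
        ≈⟨ trans (δ-*ʳ i k 1# (x j l)) (δ-cong i k (*-identityˡ (x j l))) ⟩
      δ i k (x j l) ∎

    unitMatrix-*ʳ : ∀ i j (x : M.Carrier) k l → (x M.* unitMatrix i j) k l ≈ δ j l (x k i)
    unitMatrix-*ʳ i j x k l = begin
      Σᵇ (λ m → x k m * δ i m (δ j l 1#))
        ≈⟨ Σᵇ-cong (λ m → *-congˡ {x k m} (reflexive (δ-sym i m (δ j l 1#)))) ⟩
      Σᵇ (λ m → x k m * δ m i (δ j l 1#))
        ≈⟨ Σᵇ-δ-*ʳ i (x k) (δ j l 1#) ⟩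
      x k i * δ j l 1#
        ≈⟨ trans (δ-*ˡ j l (x k i) 1#) (δ-cong j l (*-identityʳ (x k i))) ⟩
      δ j l (x k i) ∎

    unitMatrices : M.MatrixUnits
    unitMatrices = record
      { E = unitMatrix
      ; compose = λ i j k l m n → trans (unitMatrix-*ˡ i j (unitMatrix k l) m n) (collapse i j k l m n)
      ; complete = λ i j → trans
          (Σᵇ-cong λ k → reflexive (δ-sym k i (δ k j 1#))) (Σᵇ-δ i (λ k → δ k j 1#))
      }
      where
      collapse : ∀ i j k l m n → δ i m (δ k j (δ l n 1#)) ≈ M.δ j k (unitMatrix i l) m n
      collapse i false false l m n = refl
      collapse i false true  l m n = δ-0 i m
      collapse i true  false l m n = δ-0 i m
      collapse i true  true  l m n = refl

    scalar-⋈-unitMatrix : ∀ b i j → scalar.⟦ b ⟧ M.⋈[ false ] unitMatrix i j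
    scalar-⋈-unitMatrix b i j = M.mk⋈ λ k l → begin
      (scalar.⟦ b ⟧ M.* unitMatrix i j) k l ≈⟨ unitMatrix-*ʳ i j scalar.⟦ b ⟧ k l ⟩
      δ j l (δ k i b)                       ≈⟨ δ-comm j l k i b ⟩
      δ k i (δ j l b)                       ≡⟨ δ-sym k i (δ j l b) ⟩
      δ i k (δ j l b)                       ≈⟨ unitMatrix-*ˡ i j scalar.⟦ b ⟧ k l ⟨
      (unitMatrix i j M.* scalar.⟦ b ⟧) k l ∎

    Matrix-decompose : ∀ (x : M.Carrier) → M.Σᵇ (λ i → M.Σᵇ λ j → scalar.⟦ x i j ⟧ M.* unitMatrix i j) M.≈ x
    Matrix-decompose x k l = begin
      Σᵇ (λ i → Σᵇ λ j → (scalar.⟦ x i j ⟧ M.* unitMatrix i j) k l)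
        ≈⟨ Σᵇ-cong (λ i → Σᵇ-cong λ j → trans (unitMatrix-*ʳ i j scalar.⟦ x i j ⟧ k l) (reflexive (δ-sym j l _))) ⟩
      Σᵇ (λ i → Σᵇ λ j → δ l j (δ k i (x i j)))
        ≈⟨ Σᵇ-cong (λ i → Σᵇ-δ l (λ j → δ k i (x i j))) ⟩
      Σᵇ (λ i → δ k i (x i l))
        ≈⟨ Σᵇ-δ k (λ i → x i l) ⟩
      x k l ∎

    -- Commuting with the unit matrices forces a matrix to be diagonal with equal diagonal entries;
    -- commuting with scalar matrices forces that entry to be central in `B`.
    Matrix-centre : LinearBijection (centre B) (centre (Matrix B))
    Matrix-centre = record
      { ⟦_⟧ = λ (b , b-central) → scalar.⟦ b ⟧ ,
          λ x i j → trans (scalar-*ˡ b x i j) (trans (b-central (x i j)) (sym (scalar-*ʳ b x i j)))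
      ; cong = scalar.cong
      ; +-homo = λ (x , _) (y , _) → scalar.+-homo x y
      ; •-homo = λ k (x , _) → scalar.•-homo k x
      ; injective = λ x≈y → x≈y false false
      ; surjective = λ (y , y-central) →
          (y false false , λ b → trans (sym (scalar-*ʳ b y false false))
            (trans (y-central scalar.⟦ b ⟧ false false) (scalar-*ˡ b y false false))) ,
          λ
          { false false → refl
          ; false true  → shift y y-central true true false true
          ; true  false → shift y y-central false false true false
          ; true  true  → sym (shift y y-central false true false true)
          }
      }
      where
      -- This compares entry `k l` of the two products with a unit matrix. Suitable indices kill one
      -- side, showing that an off-diagonal entry vanishes, or keep both, equating the diagonal
      -- entries.
      shift : ∀ y → M.Central y → ∀ i j k l → δ j l (y k i) ≈ δ i k (y j l)
      shift y y-central i j k l = trans (sym (unitMatrix-*ʳ i j y k l))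
        (trans (y-central (unitMatrix i j) k l) (unitMatrix-*ˡ i j y k l))

  -- Homomorphisms out of B × B and M₂(B)

  module _ {B : Algebra K a ℓa} {C : Algebra K b ℓb} (h : Hom B C) where
    open AlgebraReasoning C
    private
      module B = AlgebraReasoning B
      module h = Hom h

    open SquareProperties B using (indicators)
    open MatrixProperties B using (module scalar; unitMatrix)

    module _ (I : Idempotents) (commutes : ∀ b i → h.⟦ b ⟧ ⋈[ false ] Idempotents.P I i) where
      open Idempotents I

      -- The universal property of B ⊗ (K × K): a homomorphism out of `B` extends along a complete
      -- pair of orthogonal idempotents commuting with its image. In a product the idempotents move
      -- past the coefficients and the mixed terms vanish.
      fromSquare : Hom (Square B) C
      fromSquare = record
        { ⟦_⟧     = λ x → Σᵇ λ i → h.⟦ x i ⟧ * P i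
        ; cong    = λ x≈y → Σᵇ-cong λ i → *-congʳ {P i} (h.cong (x≈y i))
        ; +-homo  = λ x y → trans
            (Σᵇ-cong λ i → trans (*-congʳ {P i} (h.+-homo (x i) (y i))) (distribʳ (P i) h.⟦ x i ⟧ h.⟦ y i ⟧))
            (Σᵇ-+ (λ i → h.⟦ x i ⟧ * P i) (λ i → h.⟦ y i ⟧ * P i))
        ; *-homo  = λ x y → sym (begin
            Σᵇ (λ i → h.⟦ x i ⟧ * P i) * Σᵇ (λ j → h.⟦ y j ⟧ * P j)
              ≈⟨ trans (Σᵇ-*ʳ (λ i → h.⟦ x i ⟧ * P i) _)
                   (Σᵇ-cong λ i → Σᵇ-*ˡ (h.⟦ x i ⟧ * P i) (λ j → h.⟦ y j ⟧ * P j)) ⟩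
            Σᵇ (λ i → Σᵇ λ j → (h.⟦ x i ⟧ * P i) * (h.⟦ y j ⟧ * P j))
              ≈⟨ Σᵇ-cong (λ i → Σᵇ-cong λ j → swap-middle h.⟦ x i ⟧ (P i) h.⟦ y j ⟧ (P j)
                   (sym (swap (commutes (y j) i)))) ⟩
            Σᵇ (λ i → Σᵇ λ j → (h.⟦ x i ⟧ * h.⟦ y j ⟧) * (P i * P j))
              ≈⟨ Σᵇ-cong (λ i → Σᵇ-cong λ j → trans (*-congˡ {h.⟦ x i ⟧ * h.⟦ y j ⟧} (orthogonal i j))
                   (δ-*ˡ i j _ (P j))) ⟩
            Σᵇ (λ i → Σᵇ λ j → δ i j ((h.⟦ x i ⟧ * h.⟦ y j ⟧) * P j))
              ≈⟨ Σᵇ-cong (λ i → Σᵇ-δ i (λ j → (h.⟦ x i ⟧ * h.⟦ y j ⟧) * P j)) ⟩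
            Σᵇ (λ i → (h.⟦ x i ⟧ * h.⟦ y i ⟧) * P i)
              ≈⟨ Σᵇ-cong (λ i → *-congʳ {P i} (h.*-homo (x i) (y i))) ⟨
            Σᵇ (λ i → h.⟦ x i B.* y i ⟧ * P i) ∎)
        ; •-homo  = λ k x → trans
            (Σᵇ-cong λ i → trans (*-congʳ (h.•-homo k (x i))) (•-*-assoc k h.⟦ x i ⟧ (P i)))
            (sym (Σᵇ-• k (λ i → h.⟦ x i ⟧ * P i)))
        ; 1#-homo = trans (Σᵇ-cong λ i → trans (*-congʳ h.1#-homo) (*-identityˡ (P i))) complete
        }

      private module from = Hom fromSquare

      fromSquare-constant : ∀ b → from.⟦ const b ⟧ ≈ h.⟦ b ⟧
      fromSquare-constant b = trans (sym (Σᵇ-*ˡ h.⟦ b ⟧ P)) (trans (*-congˡ complete) (*-identityʳ _))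

      fromSquare-indicator : ∀ j → from.⟦ AlgebraReasoning.Idempotents.P {A = Square B} indicators j ⟧ ≈ P j
      fromSquare-indicator j = trans (Σᵇ-cong λ i → trans (*-congʳ (h.δ-homo j i B.1#)) (trans (δ-*ʳ j i _ (P i))
        (δ-cong j i (trans (*-congʳ h.1#-homo) (*-identityˡ (P i)))))) (Σᵇ-δ j P)

    module _ (M : MatrixUnits) (commutes : ∀ b i j → h.⟦ b ⟧ ⋈[ false ] MatrixUnits.E M i j) where
      open MatrixUnits M

      scalars : ∀ b → Σᵇ (λ i → Σᵇ λ j → h.⟦ B.δ i j b ⟧ * E i j) ≈ h.⟦ b ⟧ * 1#
      scalars b = trans
        (Σᵇ-cong λ i → trans
          (Σᵇ-cong λ j → trans (*-congʳ (h.δ-homo i j b)) (δ-*ʳ i j h.⟦ b ⟧ (E i j)))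
          (Σᵇ-δ i (λ j → h.⟦ b ⟧ * E i j)))
        (trans (sym (Σᵇ-*ˡ h.⟦ b ⟧ (λ i → E i i))) (*-congˡ complete))

      -- The universal property of B ⊗ M₂(K). Once the matrix units have moved past the
      -- coefficients, their composition rule contracts the fourfold sum to matrix multiplication.
      fromMatrix : Hom (Matrix B) C
      fromMatrix = record
        { ⟦_⟧     = λ x → Σᵇ λ i → Σᵇ λ j → h.⟦ x i j ⟧ * E i j
        ; cong    = λ x≈y → Σᵇ-cong λ i → Σᵇ-cong λ j → *-congʳ {E i j} (h.cong (x≈y i j))
        ; +-homo  = λ x y → trans
            (Σᵇ-cong λ i → trans
              (Σᵇ-cong λ j → trans (*-congʳ {E i j} (h.+-homo (x i j) (y i j)))
                (distribʳ (E i j) h.⟦ x i j ⟧ h.⟦ y i j ⟧))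
              (Σᵇ-+ (λ j → h.⟦ x i j ⟧ * E i j) (λ j → h.⟦ y i j ⟧ * E i j)))
            (Σᵇ-+ (λ i → Σᵇ λ j → h.⟦ x i j ⟧ * E i j) (λ i → Σᵇ λ j → h.⟦ y i j ⟧ * E i j))
        ; *-homo  = λ x y → sym (begin
            Σᵇ (λ i → Σᵇ λ j → h.⟦ x i j ⟧ * E i j) * Σᵇ (λ k → Σᵇ λ l → h.⟦ y k l ⟧ * E k l)
              ≈⟨ trans (Σᵇ-*ʳ (λ i → Σᵇ λ j → h.⟦ x i j ⟧ * E i j) _) (Σᵇ-cong λ i →
                   trans (Σᵇ-*ʳ (λ j → h.⟦ x i j ⟧ * E i j) _) (Σᵇ-cong λ j →
                   trans (Σᵇ-*ˡ (h.⟦ x i j ⟧ * E i j) (λ k → Σᵇ λ l → h.⟦ y k l ⟧ * E k l)) (Σᵇ-cong λ k →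
                   Σᵇ-*ˡ (h.⟦ x i j ⟧ * E i j) (λ l → h.⟦ y k l ⟧ * E k l)))) ⟩
            Σᵇ (λ i → Σᵇ λ j → Σᵇ λ k → Σᵇ λ l → (h.⟦ x i j ⟧ * E i j) * (h.⟦ y k l ⟧ * E k l))
              ≈⟨ Σᵇ-cong (λ i → Σᵇ-cong λ j → Σᵇ-cong λ k → trans (Σᵇ-cong (λ l → term x y i j k l))
                   (δ-Σᵇ j k (λ l → (h.⟦ x i j ⟧ * h.⟦ y k l ⟧) * E i l))) ⟩
            Σᵇ (λ i → Σᵇ λ j → Σᵇ λ k → δ j k (Σᵇ λ l → (h.⟦ x i j ⟧ * h.⟦ y k l ⟧) * E i l))
              ≈⟨ Σᵇ-cong (λ i → Σᵇ-cong λ j → Σᵇ-δ j (λ k → Σᵇ λ l → (h.⟦ x i j ⟧ * h.⟦ y k l ⟧) * E i l)) ⟩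
            Σᵇ (λ i → Σᵇ λ j → Σᵇ λ l → (h.⟦ x i j ⟧ * h.⟦ y j l ⟧) * E i l)
              ≈⟨ Σᵇ-cong (λ i → Σᵇ-comm (λ j l → (h.⟦ x i j ⟧ * h.⟦ y j l ⟧) * E i l)) ⟩
            Σᵇ (λ i → Σᵇ λ l → Σᵇ λ j → (h.⟦ x i j ⟧ * h.⟦ y j l ⟧) * E i l)
              ≈⟨ Σᵇ-cong (λ i → Σᵇ-cong λ l → trans (*-congʳ (trans (h.Σᵇ-homo (λ j → x i j B.* y j l))
                   (Σᵇ-cong λ j → h.*-homo (x i j) (y j l))))
                   (Σᵇ-*ʳ (λ j → h.⟦ x i j ⟧ * h.⟦ y j l ⟧) (E i l))) ⟨
            Σᵇ (λ i → Σᵇ λ l → h.⟦ B.Σᵇ (λ j → x i j B.* y j l) ⟧ * E i l) ∎)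
        ; •-homo  = λ k x → trans
            (Σᵇ-cong λ i → trans
              (Σᵇ-cong λ j → trans (*-congʳ (h.•-homo k (x i j))) (•-*-assoc k h.⟦ x i j ⟧ (E i j)))
              (sym (Σᵇ-• k (λ j → h.⟦ x i j ⟧ * E i j))))
            (sym (Σᵇ-• k (λ i → Σᵇ λ j → h.⟦ x i j ⟧ * E i j)))
        ; 1#-homo = trans (scalars B.1#) (trans (*-congʳ h.1#-homo) (*-identityˡ 1#))
        }
        where
        term : ∀ (x y : Bool → Bool → B.Carrier) i j k l → (h.⟦ x i j ⟧ * E i j) * (h.⟦ y k l ⟧ * E k l)
                               ≈ δ j k ((h.⟦ x i j ⟧ * h.⟦ y k l ⟧) * E i l)
        term x y i j k l = trans (swap-middle _ _ _ _ (sym (swap (commutes (y k l) i j))))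
          (trans (*-congˡ (compose i j k l)) (δ-*ˡ j k _ (E i l)))

      private module from = Hom fromMatrix

      fromMatrix-scalar : ∀ b → from.⟦ scalar.⟦ b ⟧ ⟧ ≈ h.⟦ b ⟧
      fromMatrix-scalar b = trans (scalars b) (*-identityʳ _)

      fromMatrix-unitMatrix : ∀ k l → from.⟦ unitMatrix k l ⟧ ≈ E k l
      fromMatrix-unitMatrix k l = begin
        Σᵇ (λ i → Σᵇ λ j → h.⟦ B.δ k i (B.δ l j B.1#) ⟧ * E i j)
          ≈⟨ Σᵇ-cong (λ i → Σᵇ-cong λ j → trans (*-congʳ (coefficient i j))
               (trans (δ-*ʳ k i _ (E i j)) (δ-cong k i
               (trans (δ-*ʳ l j 1# (E i j)) (δ-cong l j (*-identityˡ (E i j))))))) ⟩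
        Σᵇ (λ i → Σᵇ λ j → δ k i (δ l j (E i j)))
          ≈⟨ Σᵇ-cong (λ i → trans (δ-Σᵇ k i (λ j → δ l j (E i j))) (δ-cong k i (Σᵇ-δ l (E i)))) ⟩
        Σᵇ (λ i → δ k i (E i l))
          ≈⟨ Σᵇ-δ k (λ i → E i l) ⟩
        E k l ∎
        where
        coefficient : ∀ i j → h.⟦ B.δ k i (B.δ l j B.1#) ⟧ ≈ δ k i (δ l j 1#)
        coefficient i j = trans (h.δ-homo k i _) (δ-cong k i (trans (h.δ-homo l j B.1#) (δ-cong l j h.1#-homo)))

  module _ {A : Algebra K a ℓa} {B : Algebra K b ℓb} (f : Iso A B) where
    open Iso f
    private
      module A = AlgebraReasoning A
      module B = AlgebraReasoning B

    Iso-centre : LinearBijection (centre A) (centre B)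
    Iso-centre = record
      { ⟦_⟧ = λ (x , x-central) → to.⟦ x ⟧ , λ y →
          B.trans (B.*-congˡ (B.sym (to-from y))) (B.trans (B.sym (to.*-homo x from.⟦ y ⟧))
          (B.trans (to.cong (x-central from.⟦ y ⟧)) (B.trans (to.*-homo from.⟦ y ⟧ x) (B.*-congʳ (to-from y)))))
      ; cong = to.cong
      ; +-homo = λ (x , _) (y , _) → to.+-homo x y
      ; •-homo = λ k (x , _) → to.•-homo k x
      ; injective = to-injective
      ; surjective = λ (y , y-central) → (from.⟦ y ⟧ , λ x →
          A.trans (A.*-congˡ (A.sym (from-to x))) (A.trans (A.sym (from.*-homo y to.⟦ x ⟧))
          (A.trans (from.cong (y-central to.⟦ x ⟧)) (A.trans (from.*-homo to.⟦ x ⟧ y) (A.*-congʳ (from-to x)))))) ,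
          B.sym (to-from y)
      }

    Square-Iso : Iso (Square A) (Square B)
    Square-Iso = record
      { to = map to ; from = map from
      ; from-to = λ x i → from-to (x i) ; to-from = λ x i → to-from (x i) }
      where
      map : ∀ {a ℓa b ℓb} {A : Algebra K a ℓa} {B : Algebra K b ℓb} → Hom A B → Hom (Square A) (Square B)
      map g = record
        { ⟦_⟧ = λ x i → ⟦ x i ⟧ ; cong = λ x≈y i → cong (x≈y i)
        ; +-homo = λ x y i → +-homo (x i) (y i) ; *-homo = λ x y i → *-homo (x i) (y i)
        ; •-homo = λ k x i → •-homo k (x i) ; 1#-homo = λ i → 1#-homo }
        where open Hom g

    Matrix-Iso : Iso (Matrix A) (Matrix B)
    Matrix-Iso = record
      { to = map to ; from = map from
      ; from-to = λ x i j → from-to (x i j) ; to-from = λ x i j → to-from (x i j) }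
      where
      map : ∀ {a ℓa b ℓb} {A : Algebra K a ℓa} {B : Algebra K b ℓb} → Hom A B → Hom (Matrix A) (Matrix B)
      map {A = A} {B = B} g = record
        { ⟦_⟧ = λ x i j → ⟦ x i j ⟧ ; cong = λ x≈y i j → cong (x≈y i j)
        ; +-homo = λ x y i j → +-homo (x i j) (y i j)
        ; *-homo = λ x y i j → trans (Σᵇ-homo (λ k → x i k · y k j)) (Σᵇ-cong λ k → *-homo (x i k) (y k j))
        ; •-homo = λ k x i j → •-homo k (x i j)
        ; 1#-homo = λ i j → trans (δ-homo i j _) (δ-cong i j 1#-homo) }
        where
        open Hom g
        open AlgebraReasoning B
        open Algebra A using () renaming (_*_ to _·_)

  -- A mere reordering of indices, by which a new square factor moves underneath matrices already
  -- split off. The order in which isolated vertices and planes appear thus leaves no trace in the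
  -- normal form.
  Square-Matrix : (B : Algebra K a ℓa) → Iso (Square (Matrix B)) (Matrix (Square B))
  Square-Matrix B = record
    { to = record
      { ⟦_⟧ = λ x i j k → x k i j ; cong = λ x≈y i j k → x≈y k i j
      ; +-homo = λ _ _ _ _ _ → refl ; *-homo = λ _ _ _ _ _ → refl ; •-homo = λ _ _ _ _ _ → refl
      ; 1#-homo = δ-const }
    ; from = record
      { ⟦_⟧ = λ x k i j → x i j k ; cong = λ x≈y k i j → x≈y i j k
      ; +-homo = λ _ _ _ _ _ → refl ; *-homo = λ _ _ _ _ _ → refl ; •-homo = λ _ _ _ _ _ → refl
      ; 1#-homo = λ k i j → sym (δ-const i j k) }
    ; from-to = λ _ _ _ _ → refl
    ; to-from = λ _ _ _ _ → refl
    }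
    where
    open AlgebraReasoning B
    module □ = AlgebraReasoning (Square B)
    δ-const : ∀ i j k → δ i j 1# ≈ □.δ i j □.1# k
    δ-const false false k = refl
    δ-const false true  k = refl
    δ-const true  false k = refl
    δ-const true  true  k = refl

-- The normal forms and the dimension of their centres

module _ (K : CommutativeRing c ℓ) where
  private module K = CommutativeRing K

  Scalars : Algebra K c ℓ
  Scalars = record
    { isRing       = K.isRing
    ; isLeftModule = LeftModule.isLeftModule (TensorUnit.leftModule {R = K.ring})
    ; •-*-assoc    = K.*-assoc
    ; *-•-comm     = λ k x y → K.trans (K.sym (K.*-assoc x k y))
                       (K.trans (K.*-congʳ (K.*-comm x k)) (K.*-assoc k x y))
    }

  Scalars-centre-dimension : HasDimension (centre Scalars) 1
  Scalars-centre-dimension = (λ _ → K.1# , λ x → K.*-comm K.1# x) , record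
    { independent = λ { k eq zero → K.trans (K.sym (coordinate (k zero))) eq }
    ; spanning    = λ (x , _) → (λ _ → x) , K.sym (coordinate x)
    }
    where
    coordinate : ∀ x → x K.* K.1# K.+ K.0# K.≈ x
    coordinate x = K.trans (K.+-identityʳ _) (K.*-identityʳ x)

  -- The algebra M_{2^r}(K)^{2^k}, realised as `r`-fold iterated 2 × 2 matrices over the `k`-fold
  -- square of `K`. With the squares innermost, splitting off a plane only adds an outer `Matrix`,
  -- and `Square-Model` absorbs an isolated vertex.
  Model : ℕ → ℕ → Algebra K c ℓ
  Model zero    zero    = Scalars
  Model zero    (suc k) = Square (Model zero k)
  Model (suc r) k       = Matrix (Model r k)

  Square-Model : ∀ r k → Iso (Square (Model r k)) (Model r (suc k))
  Square-Model zero    k = Iso-refl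
  Square-Model (suc r) k = Iso-trans (Square-Matrix (Model r k)) (Matrix-Iso (Square-Model r k))

  Model-centre-dimension : ∀ r k → HasDimension (centre (Model r k)) (2 ℕ.^ k)
  Model-centre-dimension zero    zero    = Scalars-centre-dimension
  Model-centre-dimension zero    (suc k) = dimension-transport (SquareProperties.Square-centre (Model zero k))
    -- `2 ^ suc k` unfolds to `2 ^ k + (2 ^ k + 0)`, whereas the direct sum has dimension
    -- `2 ^ k + 2 ^ k`.
    (≡.subst (HasDimension (DirectProduct.leftModule Z Z))
      (≡.cong (2 ℕ.^ k ℕ.+_) (≡.sym (ℕ.+-identityʳ (2 ℕ.^ k))))
      (dimension-⊕ Z Z (Model-centre-dimension zero k) (Model-centre-dimension zero k)))
    where Z = centre (Model zero k)
  Model-centre-dimension (suc r) k = dimension-transport (MatrixProperties.Matrix-centre (Model r k))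
    (Model-centre-dimension r k)

module _ {K : CommutativeRing c ℓ} where
  private module K = CommutativeRing K

  -- Algebras given by generators and relations

  module _ {X : Set} {_∼_ : Rel (Presentation.Expr K X) 0ℓ} where
    open Presentation K X
    private
      F = algebra _∼_
      module F = AlgebraReasoning F

    module _ {A : Algebra K a ℓa} (x : X → Algebra.Carrier A) where
      private module A = AlgebraReasoning A

      eval : Expr → A.Carrier
      eval (gen i) = x i
      eval 0#      = A.0#
      eval 1#      = A.1#
      eval (s + t) = eval s A.+ eval t
      eval (s * t) = eval s A.* eval t
      eval (- s)   = A.- eval s
      eval (k • s) = k A.• eval s

      module _ (eval-∼ : ∀ {s t} → s ∼ t → eval s A.≈ eval t) where

        eval-cong : ∀ {s t} → s F.≈ t → eval s A.≈ eval t
        eval-cong (relation s∼t)       = eval-∼ s∼t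
        eval-cong ≈-refl               = A.refl
        eval-cong (≈-sym p)            = A.sym (eval-cong p)
        eval-cong (≈-trans p q)        = A.trans (eval-cong p) (eval-cong q)
        eval-cong (+-cong p q)         = A.+-cong (eval-cong p) (eval-cong q)
        eval-cong (*-cong p q)         = A.*-cong (eval-cong p) (eval-cong q)
        eval-cong (-‿cong p)           = A.-‿cong (eval-cong p)
        eval-cong (•-cong k p)         = A.•-cong k (eval-cong p)
        eval-cong (+-assoc s t u)      = A.+-assoc (eval s) (eval t) (eval u)
        eval-cong (+-comm s t)         = A.+-comm (eval s) (eval t)
        eval-cong (+-identityˡ s)      = A.+-identityˡ (eval s)
        eval-cong (-‿inverseˡ s)       = A.-‿inverseˡ (eval s)
        eval-cong (*-assoc s t u)      = A.*-assoc (eval s) (eval t) (eval u)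
        eval-cong (*-identityˡ s)      = A.*-identityˡ (eval s)
        eval-cong (*-identityʳ s)      = A.*-identityʳ (eval s)
        eval-cong (*-distribˡ-+ s t u) = A.distribˡ (eval s) (eval t) (eval u)
        eval-cong (*-distribʳ-+ s t u) = A.distribʳ (eval s) (eval t) (eval u)
        eval-cong (•-identityˡ s)      = A.•-identityˡ (eval s)
        eval-cong (•-assoc k l s)      = A.•-assoc k l (eval s)
        eval-cong (•-distribˡ-+ k s t) = A.•-distribˡ k (eval s) (eval t)
        eval-cong (•-distribʳ-+ s k l) = A.•-distribʳ (eval s) k l
        eval-cong (•-*-assoc k s t)    = A.•-*-assoc k (eval s) (eval t)
        eval-cong (*-•-comm k s t)     = A.*-•-comm k (eval s) (eval t)

        evalHom : Hom F A
        evalHom = record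
          { ⟦_⟧ = eval ; cong = eval-cong
          ; +-homo = λ _ _ → A.refl ; *-homo = λ _ _ → A.refl ; •-homo = λ _ _ → A.refl
          ; 1#-homo = A.refl }

    module _ {A : Algebra K a ℓa} where
      private module A = AlgebraReasoning A

      hom-ext : (f g : Hom F A) (let module f = Hom f) (let module g = Hom g) →
                (∀ i → f.⟦ gen i ⟧ A.≈ g.⟦ gen i ⟧) → ∀ s → f.⟦ s ⟧ A.≈ g.⟦ s ⟧
      hom-ext f g f≈g = go
        where
        module f = Hom f
        module g = Hom g
        go : ∀ s → f.⟦ s ⟧ A.≈ g.⟦ s ⟧
        go (gen i) = f≈g i
        go 0#      = A.trans f.0#-homo (A.sym g.0#-homo)
        go 1#      = A.trans f.1#-homo (A.sym g.1#-homo)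
        go (s + t) = A.trans (f.+-homo s t) (A.trans (A.+-cong (go s) (go t)) (A.sym (g.+-homo s t)))
        go (s * t) = A.trans (f.*-homo s t) (A.trans (A.*-cong (go s) (go t)) (A.sym (g.*-homo s t)))
        go (- s)   = A.trans (f.-‿homo s) (A.trans (A.-‿cong (go s)) (A.sym (g.-‿homo s)))
        go (k • s) = A.trans (f.•-homo k s) (A.trans (A.•-congˡ (go s)) (A.sym (g.•-homo k s)))

      -- The elements commuting with a fixed `x` form a subalgebra, so it suffices that the images
      -- of the generators lie in it.
      centralizes : (f : Hom F A) (let module f = Hom f) → ∀ {x} →
                    (∀ i → f.⟦ gen i ⟧ A.⋈[ false ] x) → ∀ s → f.⟦ s ⟧ A.⋈[ false ] x
      centralizes f {x} gens s = A.⋈-sym (go s)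
        where
        module f = Hom f
        go : ∀ s → x A.⋈[ false ] f.⟦ s ⟧
        go (gen i) = A.⋈-sym (gens i)
        -- Zero is handled as `K.0# • 1#`, a scalar multiple of the identity.
        go 0#      = A.⋈-cong A.refl (A.trans (A.•-zeroˡ A.1#) (A.sym f.0#-homo)) (A.⋈-• K.0# (A.⋈-1 x))
        go 1#      = A.⋈-cong A.refl (A.sym f.1#-homo) (A.⋈-1 x)
        go (s + t) = A.⋈-cong A.refl (A.sym (f.+-homo s t)) (A.⋈-+ (go s) (go t))
        go (s * t) = A.⋈-cong A.refl (A.sym (f.*-homo s t)) (A.⋈-* (go s) (go t))
        go (- s)   = A.⋈-cong A.refl (A.sym (f.-‿homo s)) (A.⋈-sgn true (go s))
        go (k • s) = A.⋈-cong A.refl (A.sym (f.•-homo k s)) (A.⋈-• k (go s))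

  open CliffordGraph K public using (cliffordAlgebra)

  module _ {n} (G : SimpleGraph n) where
    open SimpleGraph G
    open CliffordGraph K G using (square; anticommute; commute)
    private module P = Presentation K (Fin n)

    -- The relations in uniform shape: one sign condition for every pair of vertices, the diagonal
    -- included, where `loopless` reduces it to an element commuting with itself. The distinction
    -- between equal and different vertices is then made once, in `generators`.
    record CliffordSystem (A : Algebra K a ℓa) : Set (a ⊔ ℓa) where
      open AlgebraReasoning A
      field
        e        : Fin n → Carrier
        e²       : ∀ i → e i * e i ≈ - 1#
        e-⋈      : ∀ i j → e i ⋈[ adjacent i j ] e j

    generators : CliffordSystem (cliffordAlgebra G)
    generators = record
      { e   = P.gen
      ; e²  = λ i → P.relation (square i)
      ; e-⋈ = e-⋈
      }
      where
      open AlgebraReasoning (cliffordAlgebra G)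
      e-⋈ : ∀ i j → P.gen i ⋈[ adjacent i j ] P.gen j
      e-⋈ i j with i ≟ j
      ... | yes ≡.refl = ⋈-resp (≡.sym (loopless i)) (⋈-refl (P.gen i))
      ... | no  i≢j with adjacent i j in eq
      ...   | true  = mk⋈ (P.relation (anticommute i≢j eq))
      ...   | false = mk⋈ (P.relation (commute i≢j eq))

    fromSystem : {A : Algebra K a ℓa} → CliffordSystem A → Hom (cliffordAlgebra G) A
    fromSystem {A = A} S = evalHom e λ
      { (square i)               → e² i
      ; (anticommute {i} {j} _ eq) → swap (⋈-resp eq (e-⋈ i j))
      ; (commute {i} {j} _ eq)     → swap (⋈-resp eq (e-⋈ i j))
      }
      where
      open AlgebraReasoning A
      open CliffordSystem S

  -- Removing one or two vertices of the graph

  module Classification (gaussian : HasHalfAndI K) where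
    open WithScalars gaussian

    module Isolated {n} (G : SimpleGraph (suc n))
                    (isolated : ∀ k → SimpleGraph.adjacent G zero (suc k) ≡ false) where
      open SimpleGraph G

      rest : SimpleGraph n
      rest = record
        { adjacent  = λ i j → adjacent (suc i) (suc j)
        ; symmetric = λ i j → symmetric (suc i) (suc j)
        ; loopless  = λ i → loopless (suc i)
        }

      private
        A = cliffordAlgebra G
        B = cliffordAlgebra rest
        module A where
          open Clifford A public
          open CliffordSystem (generators G) public
        module B where
          open Clifford B public
          open CliffordSystem (generators rest) public
        module □ = Clifford (Square B)
      open SquareProperties B

      -- The element with coordinates `ι` and `- ι`: it commutes with all constants and squares to
      -- -1, so it can be the image of the isolated generator.
      p : □.Carrier
      p = □.splitting (□.Idempotents.P indicators)

      constant-p : ∀ b → const b □.⋈[ false ] p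
      constant-p b = □.splitting-⋈ (constant-⋈-indicators b)

      systemᴬ : CliffordSystem rest A
      systemᴬ = record
        { e   = λ k → A.e (suc k)
        ; e²  = λ k → A.e² (suc k)
        ; e-⋈ = λ k l → A.e-⋈ (suc k) (suc l)
        }

      system□ : CliffordSystem G (Square B)
      system□ = record
        { e   = λ { zero → p ; (suc k) → const (B.e k) }
        ; e²  = λ { zero → □.splitting-square indicators ; (suc k) _ → B.e² k }
        ; e-⋈ = λ
          { zero    zero    → □.⋈-resp (≡.sym (loopless zero)) (□.⋈-refl p)
          ; zero    (suc l) → □.⋈-resp (≡.sym (isolated l)) (□.⋈-sym (constant-p (B.e l)))
          ; (suc k) zero    → □.⋈-resp (≡.sym (≡.trans (symmetric (suc k) zero) (isolated k))) (constant-p (B.e k))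
          ; (suc k) (suc l) → Hom.⋈-homo constant (B.e-⋈ k l)
          }
        }

      h : Hom B A
      h = fromSystem rest systemᴬ

      h-projection : ∀ b i → Hom.⟦ h ⟧ b A.⋈[ false ] A.projection (A.e zero) i
      h-projection b i = A.projection-⋈ (centralizes h
        (λ k → A.⋈-resp (≡.trans (symmetric (suc k) zero) (isolated k)) (A.e-⋈ (suc k) zero)) b) i

      to : Hom A (Square B)
      to = fromSystem G system□

      from : Hom (Square B) A
      from = fromSquare h (A.projections (A.e² zero)) h-projection

      iso : Iso A (Square B)
      iso = record
        { to = to
        ; from = from
        ; from-to = hom-ext (from ∘ᴴ to) idᴴ λ
          { zero → A.trans
              (CliffordHom.splitting-homo from (□.Idempotents.P indicators)
                (fromSquare-indicator h (A.projections (A.e² zero)) h-projection))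
              (A.splitting-projection (A.e zero))
          ; (suc k) → fromSquare-constant h (A.projections (A.e² zero)) h-projection (B.e k) }
        -- `Square B` is not given by a presentation, so this composite is computed on the defining
        -- sum of `from`: coefficients return to constants, projections to indicators, and
        -- `Square-decompose` reassembles the element.
        ; to-from = λ x → □.trans (to.Σᵇ-homo (λ i → h.⟦ x i ⟧ A.* A.projection (A.e zero) i))
            (□.trans (□.Σᵇ-cong λ i → □.trans (to.*-homo h.⟦ x i ⟧ (A.projection (A.e zero) i)) (□.*-cong
              (hom-ext (to ∘ᴴ h) constant (λ _ → □.refl) (x i))
              (□.trans (CliffordHom.projection-homo to □.refl i) (□.projection-splitting indicators i))))
            (Square-decompose x))
        }
        where
        module to = Hom to
        module h = Hom h

    module Adjacent {n} (G : SimpleGraph (suc (suc n))) (j : Fin (suc n))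
                    (adjacent-0j : SimpleGraph.adjacent G zero (suc j) ≡ true) where
      open SimpleGraph G

      other : Fin n → Fin (suc (suc n))
      other k = suc (punchIn j k)

      -- The role of a vertex relative to the plane of 0 and `suc j`. The family in the matrix
      -- algebra is built with `insertAt`, which does not reduce at an unknown index, so its
      -- relations are proved by cases on this view.
      data View : Fin (suc (suc n)) → Set where
        first  : View zero
        second : View (suc j)
        rest   : ∀ k → View (other k)

      view : ∀ i → View i
      view zero = first
      view (suc i) with j ≟ i
      ... | yes ≡.refl = second
      ... | no  j≢i    = ≡.subst (λ i → View (suc i)) (punchIn-punchOut j≢i) (rest (punchOut j≢i))

      -- The signs with which the generator k commutes with p = e₀ and with q = eⱼ.
      s t : Fin n → Bool
      s k = adjacent (other k) zero
      t k = adjacent (other k) (suc j)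

      -- The adjacency is the sign with which the products e_k · pauli (s k) (t k) commute.
      reduced : SimpleGraph n
      reduced = record
        { adjacent  = λ k l → adjacent (other k) (other l) xor ((s k ∧ t l) xor (s l ∧ t k))
        ; symmetric = λ k l → ≡.cong₂ _xor_ (symmetric (other k) (other l)) (xor-comm (s k ∧ t l) (s l ∧ t k))
        ; loopless  = λ k → ≡.cong₂ _xor_ (loopless (other k)) (xor-same (s k ∧ t k))
        }

      private
        A = cliffordAlgebra G
        B = cliffordAlgebra reduced
        module A where
          open Clifford A public
          open CliffordSystem (generators G) public
        module B where
          open Clifford B public
          open CliffordSystem (generators reduced) public
        module M = Clifford (Matrix B)
      open MatrixProperties B

      open M.PairOfUnits using (pair; pair-⋈; matrixUnit-pair)

      pairᴬ : A.AnticommutingPair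
      pairᴬ = record
        { p   = A.e zero
        ; q   = A.e (suc j)
        ; p²  = A.e² zero
        ; q²  = A.e² (suc j)
        ; p⋈q = A.⋈-resp adjacent-0j (A.e-⋈ zero (suc j))
        }

      pairᴹ : M.AnticommutingPair
      pairᴹ = pair unitMatrices

      module pᴬ = A.AnticommutingPair pairᴬ
      module pᴹ = M.AnticommutingPair pairᴹ

      systemᴬ : CliffordSystem reduced A
      systemᴬ = record
        { e   = λ k → A.e (other k) A.* pᴬ.pauli (s k) (t k)
        ; e²  = λ k → pᴬ.twist-square (A.e² (other k)) (A.e-⋈ _ _) (A.e-⋈ _ _) (s k) (t k)
            (≡.trans (≡.cong (_xor (s k ∧ t k)) (∧-comm (t k) (s k))) (xor-same (s k ∧ t k)))
        ; e-⋈ = λ k l → A.⋈-resp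
            (signs (adjacent (other k) (other l)) (s k) (t k) (s l) (t l))
            (pᴬ.twist-twist (A.e-⋈ (other k) (other l)) (A.e-⋈ _ _) (A.e-⋈ _ _) (A.e-⋈ _ _) (A.e-⋈ _ _)
              (s k) (t k) (s l) (t l))
        }
        where
        -- Each generator is twisted by its own signs, so three of the four contributions have the
        -- form `r` plus copies of `s t′ + s′ t`: there are three equal corrections, and two of them
        -- cancel modulo 2.
        signs : ∀ r s t s′ t′ →
          (r xor ((t ∧ s′) xor (s ∧ t′))) xor (((t′ ∧ s) xor (s′ ∧ t)) xor ((t′ ∧ s) xor (s′ ∧ t)))
          ≡ r xor ((s ∧ t′) xor (s′ ∧ t))
        signs = Bool.xor-∧-Solver.solve 5 (λ r s t s′ t′ →
          (r :+ ((t :* s′) :+ (s :* t′))) :+ (((t′ :* s) :+ (s′ :* t)) :+ ((t′ :* s) :+ (s′ :* t)))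
          := r :+ ((s :* t′) :+ (s′ :* t))) ≡.refl
          where open Bool.xor-∧-Solver

      scalar-⋈ : ∀ b → (scalar.⟦ b ⟧ M.⋈[ false ] pᴹ.p) × (scalar.⟦ b ⟧ M.⋈[ false ] pᴹ.q)
      scalar-⋈ b = pair-⋈ unitMatrices (scalar-⋈-unitMatrix b)

      -- The image of the generator `other k`. A scalar matrix commutes with the pair, and the Pauli
      -- factor restores the signs `s k` and `t k` that the reduction removed.
      z : Fin n → M.Carrier
      z k = scalar.⟦ B.e k ⟧ M.* pᴹ.pauli (s k) (t k)

      z-p : ∀ k → z k M.⋈[ s k ] pᴹ.p
      z-p k = pᴹ.twist-p (proj₁ (scalar-⋈ (B.e k))) (s k) (t k)

      z-q : ∀ k → z k M.⋈[ t k ] pᴹ.q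
      z-q k = pᴹ.twist-q (proj₂ (scalar-⋈ (B.e k))) (s k) (t k)

      -- The scalar parts contribute the reduced adjacency and the Pauli factors contribute exactly
      -- its correction term; the two corrections cancel and the original adjacency remains.
      z-z : ∀ k l → z k M.⋈[ adjacent (other k) (other l) ] z l
      z-z k l = M.⋈-resp
        (signs (adjacent (other k) (other l)) (s k) (t k) (s l) (t l))
        (pᴹ.twist-twist (scalar.⋈-homo (B.e-⋈ k l))
          (proj₁ (scalar-⋈ (B.e k))) (proj₂ (scalar-⋈ (B.e k)))
          (proj₁ (scalar-⋈ (B.e l))) (proj₂ (scalar-⋈ (B.e l)))
          (s k) (t k) (s l) (t l))
        where
        signs : ∀ r s t s′ t′ →
          ((r xor ((s ∧ t′) xor (s′ ∧ t))) xor ((t ∧ false) xor (s ∧ false)))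
            xor (((t′ ∧ false) xor (s′ ∧ false)) xor ((t′ ∧ s) xor (s′ ∧ t))) ≡ r
        signs = Bool.xor-∧-Solver.solve 5 (λ r s t s′ t′ →
          ((r :+ ((s :* t′) :+ (s′ :* t))) :+ ((t :* con false) :+ (s :* con false)))
            :+ (((t′ :* con false) :+ (s′ :* con false)) :+ ((t′ :* s) :+ (s′ :* t))) := r) ≡.refl
          where open Bool.xor-∧-Solver

      eᴹ : Fin (suc (suc n)) → M.Carrier
      eᴹ zero    = pᴹ.p
      eᴹ (suc i) = insertAt z j pᴹ.q i

      value : ∀ {i} → View i → M.Carrier
      value first    = pᴹ.p
      value second   = pᴹ.q
      value (rest k) = z k

      eᴹ-value : ∀ {i} (v : View i) → eᴹ i ≡ value v
      eᴹ-value first    = ≡.refl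
      eᴹ-value second   = insertAt-lookup z j pᴹ.q
      eᴹ-value (rest k) = insertAt-punchIn z j pᴹ.q k

      value² : ∀ {i} (v : View i) → M.SquaresTo-1 (value v)
      value² first    = pᴹ.p²
      value² second   = pᴹ.q²
      value² (rest k) = pᴹ.twist-square (scalar.square-homo (B.e² k))
        (proj₁ (scalar-⋈ (B.e k))) (proj₂ (scalar-⋈ (B.e k))) (s k) (t k)
        (≡.cong₂ _xor_ (∧-zeroʳ (t k)) (∧-zeroʳ (s k)))

      value-⋈ : ∀ {i i′} (v : View i) (v′ : View i′) → value v M.⋈[ adjacent i i′ ] value v′
      value-⋈ first    first    = M.⋈-resp (≡.sym (loopless zero)) (M.⋈-refl pᴹ.p)
      value-⋈ first    second   = M.⋈-resp (≡.sym adjacent-0j) pᴹ.p⋈q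
      value-⋈ first    (rest l) = M.⋈-resp (symmetric (other l) zero) (M.⋈-sym (z-p l))
      value-⋈ second   first    = M.⋈-resp (≡.trans (≡.sym adjacent-0j) (symmetric zero (suc j))) (M.⋈-sym pᴹ.p⋈q)
      value-⋈ second   second   = M.⋈-resp (≡.sym (loopless (suc j))) (M.⋈-refl pᴹ.q)
      value-⋈ second   (rest l) = M.⋈-resp (symmetric (other l) (suc j)) (M.⋈-sym (z-q l))
      value-⋈ (rest k) first    = z-p k
      value-⋈ (rest k) second   = z-q k
      value-⋈ (rest k) (rest l) = z-z k l

      systemᴹ : CliffordSystem G (Matrix B)
      systemᴹ = record
        { e   = eᴹ
        ; e²  = λ i → ≡.subst M.SquaresTo-1 (≡.sym (eᴹ-value (view i))) (value² (view i))
        ; e-⋈ = λ i i′ → ≡.subst₂ (λ x y → x M.⋈[ adjacent i i′ ] y)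
            (≡.sym (eᴹ-value (view i))) (≡.sym (eᴹ-value (view i′))) (value-⋈ (view i) (view i′))
        }

      h : Hom B A
      h = fromSystem reduced systemᴬ

      -- The twist repeats the sign already present, and `s k xor s k` vanishes. Hence the image of
      -- `h` commutes with `p` and `q`, and with the matrix units formed from them.
      h-matrixUnit : ∀ b i j → Hom.⟦ h ⟧ b A.⋈[ false ] pᴬ.matrixUnit i j
      h-matrixUnit b = pᴬ.matrixUnit-⋈ {Hom.⟦ h ⟧ b}
        (centralizes h (λ k → A.⋈-resp (xor-same (s k)) (pᴬ.twist-p (A.e-⋈ (other k) zero) (s k) (t k))) b)
        (centralizes h (λ k → A.⋈-resp (xor-same (t k)) (pᴬ.twist-q (A.e-⋈ (other k) (suc j)) (s k) (t k))) b)

      to : Hom A (Matrix B)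
      to = fromSystem G systemᴹ

      from : Hom (Matrix B) A
      from = fromMatrix h pᴬ.matrixUnits h-matrixUnit

      private
        module to = Hom to
        module from = Hom from
        module h = Hom h

      from-unitMatrix : ∀ i k → from.⟦ unitMatrix i k ⟧ A.≈ pᴬ.matrixUnit i k
      from-unitMatrix = fromMatrix-unitMatrix h pᴬ.matrixUnits h-matrixUnit

      from-p : from.⟦ pᴹ.p ⟧ A.≈ pᴬ.p
      from-p = A.trans
        (CliffordHom.splitting-homo from (λ i → unitMatrix i i) (λ i → from-unitMatrix i i)) pᴬ.p-matrixUnits

      from-q : from.⟦ pᴹ.q ⟧ A.≈ pᴬ.q
      from-q = A.trans (from.+-homo (unitMatrix false true) (M.- unitMatrix true false))
        (A.trans (A.+-cong (from-unitMatrix false true)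
        (A.trans (from.-‿homo (unitMatrix true false)) (A.-‿cong (from-unitMatrix true false)))) pᴬ.q-matrixUnits)

      -- On the remaining vertices `from` returns the original generator multiplied twice by the
      -- same Pauli involution.
      from-value : ∀ {i} (v : View i) → from.⟦ value v ⟧ A.≈ A.e i
      from-value first    = from-p
      from-value second   = from-q
      from-value (rest k) = A.trans (from.*-homo scalar.⟦ B.e k ⟧ (pᴹ.pauli (s k) (t k))) (A.trans
        (A.*-cong (fromMatrix-scalar h pᴬ.matrixUnits h-matrixUnit (B.e k))
                  (CliffordHom.pauli-homo from pairᴹ pairᴬ from-p from-q (s k) (t k)))
        (pᴬ.twist-twice _ (s k) (t k)))

      to-q : to.⟦ pᴬ.q ⟧ M.≈ pᴹ.q
      to-q = M.reflexive (eᴹ-value second)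

      to-h : ∀ b → to.⟦ h.⟦ b ⟧ ⟧ M.≈ scalar.⟦ b ⟧
      to-h = hom-ext (to ∘ᴴ h) scalar λ k → M.trans
        (M.*-cong (M.reflexive (eᴹ-value (rest k)))
                  (CliffordHom.pauli-homo to pairᴬ pairᴹ M.refl to-q (s k) (t k)))
        (pᴹ.twist-twice scalar.⟦ B.e k ⟧ (s k) (t k))

      iso : Iso A (Matrix B)
      iso = record
        { to = to
        ; from = from
        ; from-to = hom-ext (from ∘ᴴ to) idᴴ λ i → A.trans
            (from.cong (M.reflexive (eᴹ-value (view i)))) (from-value (view i))
        ; to-from = λ x → M.trans (to.Σᵇ-homo (λ i → A.Σᵇ λ k → h.⟦ x i k ⟧ A.* pᴬ.matrixUnit i k))
            (M.trans (M.Σᵇ-cong λ i → M.trans (to.Σᵇ-homo (λ k → h.⟦ x i k ⟧ A.* pᴬ.matrixUnit i k))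
              (M.Σᵇ-cong λ k → M.trans (to.*-homo h.⟦ x i k ⟧ (pᴬ.matrixUnit i k)) (M.*-cong (to-h (x i k))
                (M.trans (CliffordHom.matrixUnit-homo to pairᴬ pairᴹ M.refl to-q i k)
                         (matrixUnit-pair unitMatrices i k)))))
            (Matrix-decompose x))
        }

    module _ (G : SimpleGraph 0) where
      private
        A = cliffordAlgebra G
        module A = AlgebraReasoning A

      to-Scalars : Hom A (Scalars K)
      to-Scalars = fromSystem G (record { e = λ () ; e² = λ () ; e-⋈ = λ () })

      from-Scalars : Hom (Scalars K) A
      from-Scalars = record
        { ⟦_⟧     = λ k → k A.• A.1#
        ; cong    = λ k≈l → A.•-cong k≈l A.refl
        ; +-homo  = λ k l → A.•-distribʳ A.1# k l
        ; *-homo  = λ k l → A.trans (A.•-assoc k l A.1#) (A.trans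
            (A.•-congˡ (A.sym (A.*-identityˡ (l A.• A.1#)))) (A.sym (A.•-*-assoc k A.1# (l A.• A.1#))))
        ; •-homo  = λ k l → A.•-assoc k l A.1#
        ; 1#-homo = A.•-identityˡ A.1#
        }

      empty : Iso A (Scalars K)
      empty = record
        { to      = to-Scalars
        ; from    = from-Scalars
        ; from-to = hom-ext (from-Scalars ∘ᴴ to-Scalars) idᴴ λ ()
        ; to-from = K.*-identityʳ
        }

    classification : ∀ {n} (G : SimpleGraph n) →
      ∃[ r ] ∃[ k ] r ℕ.+ r ℕ.+ k ≡ n × Iso (cliffordAlgebra G) (Model K r k)
    classification {zero}  G = 0 , 0 , ≡.refl , empty G
    classification {suc n} G with any? (λ j → SimpleGraph.adjacent G zero (suc j) ≟ᵇ true)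
    classification {suc n} G | no ¬adjacent =
      let r , k , 2r+k≡n , f = classification rest
      in r , suc k , ≡.trans (ℕ.+-suc (r ℕ.+ r) k) (≡.cong suc 2r+k≡n) ,
         Iso-trans iso (Iso-trans (Square-Iso f) (Square-Model K r k))
      where open Isolated G (λ k → ¬-not λ eq → ¬adjacent (k , eq))
    -- A neighbour of vertex 0 among the later vertices forces at least two vertices, so this case
    -- does not arise for a single one.
    classification {suc (suc n)} G | yes (j , eq) =
      let r , k , 2r+k≡n , f = classification reduced
      in suc r , k , ≡.cong suc (≡.trans (≡.cong (ℕ._+ k) (ℕ.+-suc r r)) (≡.cong suc 2r+k≡n)) ,
         Iso-trans iso (Matrix-Iso f)
      where open Adjacent G j eq

-- The complex numbers

module _ where
  open Complexification ℝ using (_+i_; _,_; re; re-≈)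
  open CommutativeRing ℂ
  open RawMonoidSum +-rawMonoid using () renaming (_×_ to _×ᶜ_)
  open RawMonoidSum ℚ.+-0-rawMonoid using () renaming (_×_ to _×ℚ_)

  ℂ-hasHalfAndI : HasHalfAndI ℂ
  ℂ-hasHalfAndI = record
    { ι   = Real.const 0ℚ +i Real.const 1ℚ
    ; ½   = Real.const ℚ.½ +i Real.const 0ℚ
    -- All sequences involved are constant and closed, so the distance computes to `0ℚ` and `ε>0` is
    -- already the required bound.
    ; ι²  = (λ ε ε>0 → 0 , λ _ _ → ε>0) , (λ ε ε>0 → 0 , λ _ _ → ε>0)
    ; ½+½ = (λ ε ε>0 → 0 , λ _ _ → ε>0) , (λ ε ε>0 → 0 , λ _ _ → ε>0)
    }

  -- The real part of `n · 1` is a constant sequence, which reduces characteristic zero for ℂ to a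
  -- question about ℚ.
  seq-re-× : ∀ n i → Real.seq (re (n ×ᶜ 1#)) i ≡ n ×ℚ 1ℚ
  seq-re-× zero    i = ≡.refl
  seq-re-× (suc n) i = ≡.cong (1ℚ ℚ.+_) (seq-re-× n i)

  ×ℚ-mono-< : ∀ {m n} → m ℕ.< n → m ×ℚ 1ℚ ℚ.< n ×ℚ 1ℚ
  ×ℚ-mono-< {m} {suc n} m<1+n = step (ℕ.m≤n⇒m<n∨m≡n (ℕ.≤-pred m<1+n))
    where
    n<1+n : n ×ℚ 1ℚ ℚ.< suc n ×ℚ 1ℚ
    n<1+n = ≡.subst (ℚ._< suc n ×ℚ 1ℚ) (ℚ.+-identityˡ (n ×ℚ 1ℚ)) (ℚ.+-monoˡ-< (n ×ℚ 1ℚ) (ℚ.positive⁻¹ 1ℚ))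
    step : m ℕ.< n ⊎ m ≡ n → m ×ℚ 1ℚ ℚ.< suc n ×ℚ 1ℚ
    step (inj₁ m<n)    = ℚ.<-trans (×ℚ-mono-< m<n) n<1+n
    step (inj₂ ≡.refl) = n<1+n

  ×ℚ-injective : ∀ m n → m ×ℚ 1ℚ ≡ n ×ℚ 1ℚ → m ≡ n
  ×ℚ-injective m n eq with ℕ.<-cmp m n
  ... | tri< m<n _ _ = contradiction (×ℚ-mono-< m<n) (ℚ.<-irrefl eq)
  ... | tri≈ _ m≡n _ = m≡n
  ... | tri> _ _ m>n = contradiction (×ℚ-mono-< m>n) (ℚ.<-irrefl (≡.sym eq))

  -- If the distance were nonzero it could itself be taken as `ε`, and would be smaller than itself.
  -- The case distinction is available because equality in ℚ is decidable.
  const-injective : ∀ {p q} → (∀ ε → 0ℚ ℚ.< ε → ℚ.∣ p ℚ.- q ∣ ℚ.< ε) → p ≡ q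
  const-injective {p} {q} small with ℚ.∣ p ℚ.- q ∣ ℚ.≟ 0ℚ
  ... | yes ∣p-q∣≡0 = x∙y⁻¹≈ε⇒x≈y p q (ℚ.∣p∣≡0⇒p≡0 (p ℚ.- q) ∣p-q∣≡0)
    where open RingProperties ℚ.+-*-ring using (x∙y⁻¹≈ε⇒x≈y)
  ... | no  ∣p-q∣≢0 = contradiction
    (small ℚ.∣ p ℚ.- q ∣ (ℚ.≰⇒> λ ≤0 → ∣p-q∣≢0 (ℚ.≤-antisym ≤0 (ℚ.0≤∣p∣ (p ℚ.- q))))) (ℚ.<-irrefl ≡.refl)

  ℂ-characteristicZero : CharacteristicZero {K = ℂ}
  ℂ-characteristicZero m n m1≈n1 = ×ℚ-injective m n
    (const-injective λ ε ε>0 →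
      let N , close = re-≈ m1≈n1 ε ε>0
      in ≡.subst (ℚ._< ε) (≡.cong₂ (λ p q → ℚ.∣ p ℚ.- q ∣) (seq-re-× m N) (seq-re-× n N)) (close N ℕ.≤-refl))

-- Recovering the parameters from the centre, and the theorem

2^-injective : ∀ m n → 2 ℕ.^ m ≡ 2 ℕ.^ n → m ≡ n
2^-injective m n eq =
  ≡.trans (≡.sym (⌊log₂[2^n]⌋≡n m)) (≡.trans (≡.cong ⌊log₂_⌋ eq) (⌊log₂[2^n]⌋≡n n))

n+n-injective : ∀ m n → m ℕ.+ m ≡ n ℕ.+ n → m ≡ n
n+n-injective m n eq =
  ≡.trans (ℕ.n≡⌊n+n/2⌋ m) (≡.trans (≡.cong ℕ.⌊_/2⌋ eq) (≡.sym (ℕ.n≡⌊n+n/2⌋ n)))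

module _ {K : CommutativeRing c ℓ} {A : Algebra K a ℓa} {B : Algebra K b ℓb} where

  toAlgebraIsomorphism : Iso A B → AlgebraIsomorphism A B
  toAlgebraIsomorphism f = record
    { ⟦_⟧ = to.⟦_⟧
    ; isRingIsomorphism = record
      { isRingMonomorphism = record
        { isRingHomomorphism = record
          { isSemiringHomomorphism = record
            { isNearSemiringHomomorphism = record
              { +-isMonoidHomomorphism = record
                { isMagmaHomomorphism = record
                  { isRelHomomorphism = record { cong = to.cong }
                  ; homo = to.+-homo }
                ; ε-homo = to.0#-homo }
              ; *-homo = to.*-homo }
            ; 1#-homo = to.1#-homo }
          ; -‿homo = to.-‿homo }
        ; injective = to-injective
        }
      ; surjective = λ y → from.⟦ y ⟧ , λ x≈ → B.trans (to.cong x≈) (to-from y)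
      }
    ; •-homo = to.•-homo
    }
    where
    open Iso f
    module B = AlgebraReasoning B

module _ {K : CommutativeRing c ℓ} where
  private module K = CommutativeRing K

  module _ (gaussian : HasHalfAndI K) (char0 : CharacteristicZero {K = K}) where
    open Classification gaussian using (classification)

    same-centre-dimension⇒Iso : ∀ {n d} (G₁ G₂ : SimpleGraph n) →
      HasDimension (centre (cliffordAlgebra G₁)) d → HasDimension (centre (cliffordAlgebra G₂)) d →
      Iso (cliffordAlgebra G₁) (cliffordAlgebra G₂)
    same-centre-dimension⇒Iso {n} {d} G₁ G₂ dim₁ dim₂ =
      let r₁ , k₁ , 2r₁+k₁≡n , f₁ = classification G₁
          r₂ , k₂ , 2r₂+k₂≡n , f₂ = classification G₂
          k₁≡k₂ = 2^-injective k₁ k₂ (≡.trans (≡.sym (centre-dimension r₁ k₁ dim₁ f₁))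
                    (centre-dimension r₂ k₂ dim₂ f₂))
          r₁≡r₂ = n+n-injective r₁ r₂ (ℕ.+-cancelʳ-≡ k₂ (r₁ ℕ.+ r₁) (r₂ ℕ.+ r₂)
                    (≡.trans (≡.cong (r₁ ℕ.+ r₁ ℕ.+_) (≡.sym k₁≡k₂)) (≡.trans 2r₁+k₁≡n (≡.sym 2r₂+k₂≡n))))
      in Iso-trans (≡.subst₂ (λ r k → Iso (cliffordAlgebra G₁) (Model K r k)) r₁≡r₂ k₁≡k₂ f₁) (Iso-sym f₂)
      where
      centre-dimension : ∀ {G : SimpleGraph n} r k → HasDimension (centre (cliffordAlgebra G)) d →
                         Iso (cliffordAlgebra G) (Model K r k) → d ≡ 2 ℕ.^ k
      centre-dimension r k dim f = dimension-unique {K = K} char0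
        (dimension-transport (Iso-centre f) dim) (Model-centre-dimension K r k)

mainTheorem1 : (n : ℕ) → n ≥ 1 → (G₁ G₂ : SimpleGraph n) →
    (d₁ d₂ : ℕ) →
    HasDimension (centre (CliffordGraphAlgebra G₁)) d₁ →
    HasDimension (centre (CliffordGraphAlgebra G₂)) d₂ →
    d₁ ≡ d₂ →
    AlgebraIsomorphism (CliffordGraphAlgebra G₁) (CliffordGraphAlgebra G₂)
mainTheorem1 n _ G₁ G₂ d .d dim₁ dim₂ ≡.refl = toAlgebraIsomorphism
  (same-centre-dimension⇒Iso ℂ-hasHalfAndI ℂ-characteristicZero G₁ G₂ dim₁ dim₂)
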